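{- Any quantum algorithm which estimates the distances of a metric space of $n$ points (given by oracle access to the distances) within a constant approximation factor has query complexity at least $\Omega(n^{3/2})$.
   Context: Estimating within approximation factor $\alpha$ means outputting an $n\times n$ matrix $A$ with $d(p_i,p_j)\le A[i][j]\le \alpha\,d(p_i,p_j)$ for all $i,j$, where the distances are available only via an oracle returning $d(p_i,p_j)$ on input $(i,j)$. -}

module Defs where

open import Algebra.Bundles using (RawMonoid)
import Algebra.Definitions.RawMonoid as MonoidSum
open import Data.Bool using (Bool; true; false; if_then_else_; T; _xor_)
import Data.Bool.Properties as Bool
open import Data.Fin using (Fin; zero; suc)
import Data.Fin.Properties as Fin
open import Data.Integer as ℤ using (+_; -[1+_])
import Data.Integer.Properties as ℤ
open import Data.Nat as ℕ using (ℕ; zero; suc)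
import Data.Nat.Properties as ℕ
import Data.Nat.Solver as ℕ-Solver
open import Data.Product using (Σ; ∃; ∃-syntax; _×_; _,_; proj₁; proj₂)
import Data.Product.Properties as Product
open import Data.Rational as ℚ using (ℚ; mkℚ; 0ℚ; 1ℚ; _/_; ∣_∣)
import Data.Rational.Properties as ℚ
open import Data.Rational.Solver using (module +-*-Solver)
import Data.Rational.Unnormalised as ℚᵘ
import Data.Rational.Unnormalised.Properties as ℚᵘ
open import Data.Sum using (inj₁; inj₂)
open import Data.Vec using (Vec; []; _∷_; zipWith)
import Data.Vec.Properties as Vec
open import Function using (_∘_)
open import Function.Definitions using (Injective)
import Function.Metric.Structures as Metric
open import Level using (0ℓ)
open import Relation.Binary.Definitions using (DecidableEquality)
open import Relation.Binary.PropositionalEquality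
  using (_≡_; refl; sym; trans; cong; cong₂; subst)
open import Relation.Nullary using (yes; no; does)

-- ℝ consists of Cauchy sequences of rationals, with setoid equality _≈_.

IsCauchy : (ℕ → ℚ) → Set
IsCauchy x = ∀ ε → 0ℚ ℚ.< ε →
  ∃[ N ] (∀ m n → N ℕ.≤ m → N ℕ.≤ n → ∣ x m ℚ.- x n ∣ ℚ.≤ ε)

record ℝ : Set where
  constructor mkℝ
  field
    seq    : ℕ → ℚ
    cauchy : IsCauchy seq

open ℝ public

infix 4 _≈_ _≤_ _<_

_≈_ : ℝ → ℝ → Set
x ≈ y = ∀ ε → 0ℚ ℚ.< ε → ∃[ N ] (∀ n → N ℕ.≤ n → ∣ seq x n ℚ.- seq y n ∣ ℚ.≤ ε)

_≤_ : ℝ → ℝ → Set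
x ≤ y = ∀ ε → 0ℚ ℚ.< ε → ∃[ N ] (∀ n → N ℕ.≤ n → seq x n ℚ.≤ seq y n ℚ.+ ε)

_<_ : ℝ → ℝ → Set
x < y = ∃[ ε ] (0ℚ ℚ.< ε × ∃[ N ] (∀ n → N ℕ.≤ n → seq x n ℚ.+ ε ℚ.≤ seq y n))

-- The Cauchy proofs are abstract: equality and order depend only on seq, and
-- unfolding them makes terms very large.
abstract
  const-cauchy : ∀ q → IsCauchy (λ _ → q)
  const-cauchy q ε 0<ε = 0 , λ _ _ _ _ →
    subst (λ z → ∣ z ∣ ℚ.≤ ε) (sym (ℚ.+-inverseʳ q)) (ℚ.<⇒≤ 0<ε)

fromℚ : ℚ → ℝ
fromℚ q = mkℝ (λ _ → q) (const-cauchy q)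

fromℕ : ℕ → ℝ
fromℕ n = fromℚ (+ n / 1)

0ℝ 1ℝ : ℝ
0ℝ = fromℚ 0ℚ
1ℝ = fromℚ 1ℚ

private
  pos+ : ∀ {p q} → 0ℚ ℚ.< p → 0ℚ ℚ.< q → 0ℚ ℚ.< p ℚ.+ q
  pos+ = ℚ.+-mono-<

  pos* : ∀ {p q} → 0ℚ ℚ.< p → 0ℚ ℚ.< q → 0ℚ ℚ.< p ℚ.* q
  pos* {p} {q} 0<p 0<q = ℚ.positive⁻¹ (p ℚ.* q) {{ℚ.pos*pos⇒pos p {{ℚ.positive 0<p}} q {{ℚ.positive 0<q}}}}

  *-mono : ∀ {p q r s} → 0ℚ ℚ.≤ r → 0ℚ ℚ.≤ q → p ℚ.≤ q → r ℚ.≤ s → p ℚ.* r ℚ.≤ q ℚ.* s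
  *-mono {p} {q} {r} {s} 0≤r 0≤q p≤q r≤s = ℚ.≤-trans
    (ℚ.*-monoʳ-≤-nonNeg r {{ℚ.nonNegative 0≤r}} p≤q)
    (ℚ.*-monoˡ-≤-nonNeg q {{ℚ.nonNegative 0≤q}} r≤s)

  split : ∀ {b ε} → 0ℚ ℚ.< b → 0ℚ ℚ.< ε → ∃[ δ ] (0ℚ ℚ.< δ × b ℚ.* δ ≡ ε)
  split {b} {ε} 0<b 0<ε = 1/b ℚ.* ε , pos* (ℚ.positive⁻¹ 1/b {{ℚ.1/pos⇒pos b {{b⁺}}}}) 0<ε ,
    trans (sym (ℚ.*-assoc b 1/b ε))
      (trans (cong (ℚ._* ε) (ℚ.*-inverseʳ b {{b≠0}})) (ℚ.*-identityˡ ε))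
    where
    b⁺ = ℚ.positive 0<b
    b≠0 = ℚ.pos⇒nonZero b {{b⁺}}
    1/b = (ℚ.1/ b) {{b≠0}}

  eventually-bounded : ∀ x → ∃[ B ] (0ℚ ℚ.< B × ∃[ N ] (∀ n → N ℕ.≤ n → ∣ seq x n ∣ ℚ.≤ B))
  eventually-bounded x with cauchy x 1ℚ (ℚ.positive⁻¹ 1ℚ)
  ... | N , close = 1ℚ ℚ.+ ∣ a ∣ , ℚ.+-mono-<-≤ (ℚ.positive⁻¹ 1ℚ) (ℚ.0≤∣p∣ a) , N , λ n N≤n →
    ℚ.≤-trans
      (subst (λ z → ∣ z ∣ ℚ.≤ ∣ seq x n ℚ.- a ∣ ℚ.+ ∣ a ∣)
        (solve 2 (λ u v → (u :- v) :+ v := u) refl (seq x n) a)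
        (ℚ.∣p+q∣≤∣p∣+∣q∣ (seq x n ℚ.- a) a))
      (ℚ.+-monoˡ-≤ ∣ a ∣ (close n N N≤n ℕ.≤-refl))
    where
    open +-*-Solver
    a = seq x N

  within : ∀ {a b ε} → a ℚ.≤ b ℚ.+ ε → b ℚ.≤ a ℚ.+ ε → ∣ a ℚ.- b ∣ ℚ.≤ ε
  within {a} {b} {ε} a≤ b≤ with ℚ.∣p∣≡p∨∣p∣≡-p (a ℚ.- b)
  ... | inj₁ eq = subst (ℚ._≤ ε) (sym eq)
    (subst (a ℚ.- b ℚ.≤_) (solve 2 (λ u v → (u :+ v) :- u := v) refl b ε)
      (ℚ.+-monoˡ-≤ (ℚ.- b) a≤))
    where open +-*-Solver
  ... | inj₂ eq = subst (ℚ._≤ ε) (sym (trans eq (solve 2 (λ u v → :- (u :- v) := v :- u) refl a b)))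
    (subst (b ℚ.- a ℚ.≤_) (solve 2 (λ u v → (u :+ v) :- u := v) refl a ε)
      (ℚ.+-monoˡ-≤ (ℚ.- a) b≤))
    where open +-*-Solver

infixl 6 _+_
infixl 7 _*_
infix  8 -_

abstract
  +-cauchy : ∀ x y → IsCauchy (λ n → seq x n ℚ.+ seq y n)
  +-cauchy x y ε 0<ε with split (pos+ (ℚ.positive⁻¹ 1ℚ) (ℚ.positive⁻¹ 1ℚ)) 0<ε
  ... | δ , 0<δ , 2δ≡ε with cauchy x δ 0<δ | cauchy y δ 0<δ
  ... | M , x-close | N , y-close = M ℕ.⊔ N , λ m n ≤m ≤n →
    subst (λ z → ∣ z ∣ ℚ.≤ ε)
      (solve 4 (λ a b c d → (a :- b) :+ (c :- d) := (a :+ c) :- (b :+ d)) refl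
        (seq x m) (seq x n) (seq y m) (seq y n))
      (ℚ.≤-trans (ℚ.∣p+q∣≤∣p∣+∣q∣ (seq x m ℚ.- seq x n) (seq y m ℚ.- seq y n))
        (subst (∣ seq x m ℚ.- seq x n ∣ ℚ.+ ∣ seq y m ℚ.- seq y n ∣ ℚ.≤_)
          (trans (cong₂ ℚ._+_ (sym (ℚ.*-identityˡ δ)) (sym (ℚ.*-identityˡ δ)))
            (trans (sym (ℚ.*-distribʳ-+ δ 1ℚ 1ℚ)) 2δ≡ε))
          (ℚ.+-mono-≤
            (x-close m n (ℕ.m⊔n≤o⇒m≤o M N ≤m) (ℕ.m⊔n≤o⇒m≤o M N ≤n))
            (y-close m n (ℕ.m⊔n≤o⇒n≤o M N ≤m) (ℕ.m⊔n≤o⇒n≤o M N ≤n)))))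
    where open +-*-Solver

_+_ : ℝ → ℝ → ℝ
x + y = mkℝ (λ n → seq x n ℚ.+ seq y n) (+-cauchy x y)

abstract
  neg-cauchy : ∀ x → IsCauchy (λ n → ℚ.- seq x n)
  neg-cauchy x ε 0<ε =
    let N , close = cauchy x ε 0<ε in N , λ m n N≤m N≤n →
      subst (λ z → ∣ z ∣ ℚ.≤ ε) (flip (seq x n) (seq x m)) (close n m N≤n N≤m)
    where
    open +-*-Solver
    flip : ∀ a b → a ℚ.- b ≡ ℚ.- b ℚ.- ℚ.- a
    flip = solve 2 (λ a b → a :- b := :- b :- :- a) refl

-_ : ℝ → ℝ
- x = mkℝ (λ n → ℚ.- seq x n) (neg-cauchy x)

private
  *-close : ∀ {a b c d B C δ} → ∣ a ∣ ℚ.≤ B → ∣ d ∣ ℚ.≤ C → 0ℚ ℚ.≤ B → 0ℚ ℚ.≤ C →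
            ∣ a ℚ.- b ∣ ℚ.≤ δ → ∣ c ℚ.- d ∣ ℚ.≤ δ →
            ∣ a ℚ.* c ℚ.- b ℚ.* d ∣ ℚ.≤ (B ℚ.+ C) ℚ.* δ
  *-close {a} {b} {c} {d} {B} {C} {δ} a≤B d≤C 0≤B 0≤C ab cd = begin
    ∣ a ℚ.* c ℚ.- b ℚ.* d ∣                      ≡⟨ cong ∣_∣ (rearrange a b c d) ⟩
    ∣ a ℚ.* (c ℚ.- d) ℚ.+ d ℚ.* (a ℚ.- b) ∣      ≤⟨ ℚ.∣p+q∣≤∣p∣+∣q∣ (a ℚ.* (c ℚ.- d)) (d ℚ.* (a ℚ.- b)) ⟩
    ∣ a ℚ.* (c ℚ.- d) ∣ ℚ.+ ∣ d ℚ.* (a ℚ.- b) ∣  ≡⟨ cong₂ ℚ._+_ (ℚ.∣p*q∣≡∣p∣*∣q∣ a (c ℚ.- d)) (ℚ.∣p*q∣≡∣p∣*∣q∣ d (a ℚ.- b)) ⟩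
    ∣ a ∣ ℚ.* ∣ c ℚ.- d ∣ ℚ.+ ∣ d ∣ ℚ.* ∣ a ℚ.- b ∣
      ≤⟨ ℚ.+-mono-≤ (*-mono {∣ a ∣} {B} {∣ c ℚ.- d ∣} {δ} (ℚ.0≤∣p∣ (c ℚ.- d)) 0≤B a≤B cd)
                    (*-mono {∣ d ∣} {C} {∣ a ℚ.- b ∣} {δ} (ℚ.0≤∣p∣ (a ℚ.- b)) 0≤C d≤C ab) ⟩
    B ℚ.* δ ℚ.+ C ℚ.* δ                          ≡⟨ sym (ℚ.*-distribʳ-+ δ B C) ⟩
    (B ℚ.+ C) ℚ.* δ                              ∎
    where
    open ℚ.≤-Reasoning
    open +-*-Solver
    rearrange : ∀ a b c d → a ℚ.* c ℚ.- b ℚ.* d ≡ a ℚ.* (c ℚ.- d) ℚ.+ d ℚ.* (a ℚ.- b)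
    rearrange = solve 4 (λ a b c d → a :* c :- b :* d := a :* (c :- d) :+ d :* (a :- b)) refl

abstract
  *-cauchy : ∀ x y → IsCauchy (λ n → seq x n ℚ.* seq y n)
  *-cauchy x y ε 0<ε =
    let
      B , 0<B , N₁ , x≤B = eventually-bounded x
      C , 0<C , N₂ , y≤C = eventually-bounded y
      δ , 0<δ , eq = split {B ℚ.+ C} {ε} (pos+ {B} {C} 0<B 0<C) 0<ε
      N₃ , x-close = cauchy x δ 0<δ
      N₄ , y-close = cauchy y δ 0<δ
    in (N₁ ℕ.⊔ N₂) ℕ.⊔ (N₃ ℕ.⊔ N₄) , λ m n ≤m ≤n → let
      m₁₂ = ℕ.m⊔n≤o⇒m≤o (N₁ ℕ.⊔ N₂) (N₃ ℕ.⊔ N₄) ≤m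
      n₁₂ = ℕ.m⊔n≤o⇒m≤o (N₁ ℕ.⊔ N₂) (N₃ ℕ.⊔ N₄) ≤n
      m₃₄ = ℕ.m⊔n≤o⇒n≤o (N₁ ℕ.⊔ N₂) (N₃ ℕ.⊔ N₄) ≤m
      n₃₄ = ℕ.m⊔n≤o⇒n≤o (N₁ ℕ.⊔ N₂) (N₃ ℕ.⊔ N₄) ≤n
    in subst (∣ seq x m ℚ.* seq y m ℚ.- seq x n ℚ.* seq y n ∣ ℚ.≤_) eq
      (*-close {seq x m} {seq x n} {seq y m} {seq y n} {B} {C} {δ}
        (x≤B m (ℕ.m⊔n≤o⇒m≤o N₁ N₂ m₁₂)) (y≤C n (ℕ.m⊔n≤o⇒n≤o N₁ N₂ n₁₂))
        (ℚ.<⇒≤ 0<B) (ℚ.<⇒≤ 0<C)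
        (x-close m n (ℕ.m⊔n≤o⇒m≤o N₃ N₄ m₃₄) (ℕ.m⊔n≤o⇒m≤o N₃ N₄ n₃₄))
        (y-close m n (ℕ.m⊔n≤o⇒n≤o N₃ N₄ m₃₄) (ℕ.m⊔n≤o⇒n≤o N₃ N₄ n₃₄)))

_*_ : ℝ → ℝ → ℝ
x * y = mkℝ (λ n → seq x n ℚ.* seq y n) (*-cauchy x y)

isqrt : ∀ m → ∃[ r ] (r ℕ.* r ℕ.≤ m × m ℕ.< suc r ℕ.* suc r)
isqrt zero = 0 , ℕ.z≤n , ℕ.s≤s ℕ.z≤n
isqrt (suc m) with isqrt m
... | r , lo , hi with suc r ℕ.* suc r ℕ.≤? suc m
... | yes le = suc r , le , ℕ.≤-<-trans hi (ℕ.*-mono-< (ℕ.n<1+n (suc r)) (ℕ.n<1+n (suc r)))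
... | no gt  = r , ℕ.m≤n⇒m≤1+n lo , ℕ.≰⇒> gt

private
  square-cancel-≤ : ∀ {a b} → a ℕ.* a ℕ.≤ b ℕ.* b → a ℕ.≤ b
  square-cancel-≤ {a} {b} le with a ℕ.≤? b
  ... | yes a≤b = a≤b
  ... | no a≰b with () ← ℕ.<⇒≱ (ℕ.*-mono-< (ℕ.≰⇒> a≰b) (ℕ.≰⇒> a≰b)) le

  /-mono : ∀ a b j k → a ℕ.* suc k ℕ.≤ b ℕ.* suc j → + a / suc j ℚ.≤ + b / suc k
  /-mono a b j k le = ℚ.toℚᵘ-cancel-≤
    (ℚᵘ.≤-respˡ-≃ (ℚᵘ.≃-sym (ℚ.toℚᵘ-fromℚᵘ (ℚᵘ.mkℚᵘ (+ a) j)))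
      (ℚᵘ.≤-respʳ-≃ (ℚᵘ.≃-sym (ℚ.toℚᵘ-fromℚᵘ (ℚᵘ.mkℚᵘ (+ b) k)))
        (ℚᵘ.*≤* (ℤ.≤-trans (ℤ.≤-reflexive (sym (ℤ.pos-* a (suc k))))
          (ℤ.≤-trans (ℤ.+≤+ le) (ℤ.≤-reflexive (ℤ.pos-* b (suc j))))))))

  /-suc : ∀ a k → + suc a / suc k ≡ + a / suc k ℚ.+ + 1 / suc k
  /-suc a k = ℚ.toℚᵘ-injective (ℚᵘ.≃-trans (ℚ.toℚᵘ-fromℚᵘ (ℚᵘ.mkℚᵘ (+ suc a) k))
    (ℚᵘ.≃-sym (ℚᵘ.≃-trans (ℚ.toℚᵘ-homo-+ (+ a / suc k) (+ 1 / suc k))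
      (ℚᵘ.≃-trans (ℚᵘ.+-cong (ℚ.toℚᵘ-fromℚᵘ (ℚᵘ.mkℚᵘ (+ a) k)) (ℚ.toℚᵘ-fromℚᵘ (ℚᵘ.mkℚᵘ (+ 1) k)))
        (ℚᵘ.*≡* eq)))))
    where
    d = + suc k
    eq : (+ a ℤ.* d ℤ.+ + 1 ℤ.* d) ℤ.* d ≡ + suc a ℤ.* (d ℤ.* d)
    eq = trans (cong (ℤ._* d) (sym (ℤ.*-distribʳ-+ d (+ a) (+ 1))))
      (trans (ℤ.*-assoc (+ a ℤ.+ + 1) d d)
        (cong (ℤ._* (d ℤ.* d)) (ℤ.+-comm (+ a) (+ 1))))

  1/-small : ∀ ε → 0ℚ ℚ.< ε → ∃[ N ] (∀ k → N ℕ.≤ k → + 1 / suc k ℚ.≤ ε)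
  1/-small ε@(mkℚ (+ zero) _ _) 0<ε with () ← ℚ.positive 0<ε
  1/-small ε@(mkℚ -[1+ _ ] _ _) 0<ε with () ← ℚ.positive 0<ε
  1/-small ε@(mkℚ (+ suc p) d _) _ = d , λ k d≤k →
    subst (+ 1 / suc k ℚ.≤_) (ℚ.↥p/↧p≡p ε)
      (/-mono 1 (suc p) k d
        (ℕ.≤-trans (ℕ.≤-reflexive (ℕ.*-identityˡ (suc d)))
          (ℕ.≤-trans (ℕ.s≤s d≤k) (ℕ.m≤m+n (suc k) (p ℕ.* suc k)))))

-- The sequence ⌊ √ (m (k + 1)²) ⌋ / (k + 1) converges to √ m.
√-seq : ℕ → ℕ → ℚ
√-seq m k = + proj₁ (isqrt (m ℕ.* (suc k ℕ.* suc k))) / suc k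

abstract
  √-cauchy : ∀ m → IsCauchy (√-seq m)
  √-cauchy m ε 0<ε = let N , small = 1/-small ε 0<ε in N , λ j k N≤j N≤k →
    within {s j} {s k} {ε} (s-≤ j k (small k N≤k)) (s-≤ k j (small j N≤j))
    where
    r : ℕ → ℕ
    r k = proj₁ (isqrt (m ℕ.* (suc k ℕ.* suc k)))

    s : ℕ → ℚ
    s = √-seq m

    swap : ∀ u v w → u ℕ.* (v ℕ.* v) ℕ.* (w ℕ.* w) ≡ u ℕ.* (w ℕ.* w) ℕ.* (v ℕ.* v)
    swap = solve 3 (λ u v w → u :* (v :* v) :* (w :* w) := u :* (w :* w) :* (v :* v)) refl
      where open ℕ-Solver.+-*-Solver

    sq : ∀ u v → (u ℕ.* v) ℕ.* (u ℕ.* v) ≡ (u ℕ.* u) ℕ.* (v ℕ.* v)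
    sq = solve 2 (λ u v → (u :* v) :* (u :* v) := (u :* u) :* (v :* v)) refl
      where open ℕ-Solver.+-*-Solver

    r-≤ : ∀ j k → r j ℕ.* suc k ℕ.≤ suc (r k) ℕ.* suc j
    r-≤ j k = square-cancel-≤ (begin
      (r j ℕ.* suc k) ℕ.* (r j ℕ.* suc k)             ≡⟨ sq (r j) (suc k) ⟩
      (r j ℕ.* r j) ℕ.* (suc k ℕ.* suc k)             ≤⟨ ℕ.*-monoˡ-≤ (suc k ℕ.* suc k) (proj₁ (proj₂ (isqrt (m ℕ.* (suc j ℕ.* suc j))))) ⟩
      m ℕ.* (suc j ℕ.* suc j) ℕ.* (suc k ℕ.* suc k)   ≡⟨ swap m (suc j) (suc k) ⟩
      m ℕ.* (suc k ℕ.* suc k) ℕ.* (suc j ℕ.* suc j)   ≤⟨ ℕ.*-monoˡ-≤ (suc j ℕ.* suc j) (ℕ.<⇒≤ (proj₂ (proj₂ (isqrt (m ℕ.* (suc k ℕ.* suc k)))))) ⟩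
      (suc (r k) ℕ.* suc (r k)) ℕ.* (suc j ℕ.* suc j) ≡⟨ sym (sq (suc (r k)) (suc j)) ⟩
      (suc (r k) ℕ.* suc j) ℕ.* (suc (r k) ℕ.* suc j) ∎)
      where open ℕ.≤-Reasoning

    s-≤ : ∀ {ε} j k → + 1 / suc k ℚ.≤ ε → s j ℚ.≤ s k ℚ.+ ε
    s-≤ j k small = ℚ.≤-trans (/-mono (r j) (suc (r k)) j k (r-≤ j k))
      (ℚ.≤-trans (ℚ.≤-reflexive (/-suc (r k) k)) (ℚ.+-monoʳ-≤ (s k) small))

√ : ℕ → ℝ
√ m = mkℝ (√-seq m) (√-cauchy m)

infix 9 _^[3/2]

_^[3/2] : ℕ → ℝ
n ^[3/2] = √ (n ℕ.^ 3)

+-0-rawMonoidᴿ : RawMonoid 0ℓ 0ℓ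
+-0-rawMonoidᴿ = record { Carrier = ℝ ; _≈_ = _≈_ ; _∙_ = _+_ ; ε = 0ℝ }

record ℂ : Set where
  constructor _+i_
  field
    re im : ℝ

open ℂ public

infix  4 _≈ᶜ_
infixl 6 _+ᶜ_
infixl 7 _*ᶜ_

_≈ᶜ_ : ℂ → ℂ → Set
x ≈ᶜ y = re x ≈ re y × im x ≈ im y

_+ᶜ_ : ℂ → ℂ → ℂ
x +ᶜ y = (re x + re y) +i (im x + im y)

_*ᶜ_ : ℂ → ℂ → ℂ
x *ᶜ y = (re x * re y + - (im x * im y)) +i (re x * im y + im x * re y)

0ℂ 1ℂ : ℂ
0ℂ = 0ℝ +i 0ℝ
1ℂ = 1ℝ +i 0ℝ

conj : ℂ → ℂ
conj x = re x +i (- im x)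

∣_∣² : ℂ → ℝ
∣ x ∣² = re x * re x + im x * im x

+-0-rawMonoidᶜ : RawMonoid 0ℓ 0ℓ
+-0-rawMonoidᶜ = record { Carrier = ℂ ; _≈_ = _≈ᶜ_ ; _∙_ = _+ᶜ_ ; ε = 0ℂ }

-- A basis state ∣ i , j , z , a ⟩ has query registers i and j, a b-bit
-- answer register z, and a workspace register a of arbitrary finite
-- dimension w.
Basis : (n b w : ℕ) → Set
Basis n b w = Fin n × Fin n × Vec Bool b × Fin w

infix 4 _≟_

_≟_ : ∀ {n b w} → DecidableEquality (Basis n b w)
_≟_ = Product.≡-dec Fin._≟_ (Product.≡-dec Fin._≟_ (Product.≡-dec (Vec.≡-dec Bool._≟_) Fin._≟_))

module BasisSum (M : RawMonoid 0ℓ 0ℓ) where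
  open RawMonoid M using (Carrier; _∙_)
  open MonoidSum M using (sum)

  sumBits : ∀ {b} → (Vec Bool b → Carrier) → Carrier
  sumBits {zero}  f = f []
  sumBits {suc b} f = sumBits (f ∘ (false ∷_)) ∙ sumBits (f ∘ (true ∷_))

  sumBasis : ∀ {n b w} → (Basis n b w → Carrier) → Carrier
  sumBasis f = sum λ i → sum λ j → sumBits λ z → sum λ a → f (i , j , z , a)

open BasisSum +-0-rawMonoidᴿ public using () renaming (sumBasis to ∑ᴿ)
open BasisSum +-0-rawMonoidᶜ public using () renaming (sumBasis to ∑ᶜ)

State : (n b w : ℕ) → Set
State n b w = Basis n b w → ℂ

Operator : (n b w : ℕ) → Set
Operator n b w = Basis n b w → Basis n b w → ℂ

module _ {n b w : ℕ} where

  ket : Basis n b w → State n b w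
  ket s t = if does (s ≟ t) then 1ℂ else 0ℂ

  identity : Operator n b w
  identity = ket

  infixr 7 _·_ _⊙_

  _·_ : Operator n b w → State n b w → State n b w
  (U · ψ) s = ∑ᶜ λ t → U s t *ᶜ ψ t

  _⊙_ : Operator n b w → Operator n b w → Operator n b w
  (U ⊙ V) s t = ∑ᶜ λ u → U s u *ᶜ V u t

  infix 8 _†

  _† : Operator n b w → Operator n b w
  (U †) s t = conj (U t s)

  IsUnitary : Operator n b w → Set
  IsUnitary U = (∀ s t → (U † ⊙ U) s t ≈ᶜ identity s t)
              × (∀ s t → (U ⊙ U †) s t ≈ᶜ identity s t)

  -- ∣ i , j , z , a ⟩ ↦ ∣ i , j , z ⊕ X i j , a ⟩.  Since z ↦ z ⊕ X i j is
  -- an involution, the new amplitude at z is the old one at z ⊕ X i j.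
  oracle : (Fin n → Fin n → Vec Bool b) → State n b w → State n b w
  oracle X ψ (i , j , z , a) = ψ (i , j , zipWith _xor_ z (X i j) , a)

  -- U_q O_X U_{q-1} ⋯ U_1 O_X U_0 ψ
  run : ∀ {q} → (Fin (suc q) → Operator n b w) → (Fin n → Fin n → Vec Bool b) →
        State n b w → State n b w
  run {zero}  U X ψ = U zero · ψ
  run {suc q} U X ψ = run (U ∘ suc) X (oracle X (U zero · ψ))

  -- Probability that measuring ψ in the computational basis yields an
  -- outcome in S.
  Pr : State n b w → (Basis n b w → Bool) → ℝ
  Pr ψ S = ∑ᴿ λ s → if S s then ∣ ψ s ∣² else 0ℝ

DistanceMatrix : ℕ → Set
DistanceMatrix n = Fin n → Fin n → ℝ

-- d i j is the distance between the points p_i and p_j.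
IsMetric : ∀ {n} → DistanceMatrix n → Set
IsMetric = Metric.IsGeneralMetric _≡_ _≈_ _≤_ 0ℝ _+_

Approximates : ∀ {n} → ℝ → DistanceMatrix n → DistanceMatrix n → Set
Approximates α d A = ∀ i j → d i j ≤ A i j × A i j ≤ α * d i j

-- The answer register holds a distance as a bit string.  Any finite metric
-- space takes finitely many distances, so its distances are the values of
-- some code.
record Code : Set where
  field
    bits      : ℕ
    value     : Vec Bool bits → ℝ
    injective : Injective _≡_ _≈_ value

open Code public

record Circuit (n b q : ℕ) : Set where
  field
    workspace : ℕ
    initial   : Basis n b workspace
    gate      : Fin (suc q) → Operator n b workspace
    unitary   : ∀ k → IsUnitary (gate k)
    output    : Basis n b workspace → DistanceMatrix n

  final : (Fin n → Fin n → Vec Bool b) → State n b workspace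
  final X = run gate X (ket initial)

-- Query complexity is a worst case over all metric spaces on n points, so an
-- algorithm has a circuit for every code, with q independent of the code.
QuantumAlgorithm : (n q : ℕ) → Set
QuantumAlgorithm n q = (C : Code) → Circuit n (bits C) q

-- Correctness of a real output matrix is not decidable, so "the output is
-- correct with probability at least 2/3" is expressed by a decidable set S of
-- measurement outcomes, all correct, of total probability at least 2/3.
Estimates : ∀ {n q} → ℝ → QuantumAlgorithm n q → Set
Estimates {n} α 𝒜 = ∀ (C : Code) (X : Fin n → Fin n → Vec Bool (bits C)) →
  let d = λ i j → value C (X i j)
      open Circuit (𝒜 C)
  in IsMetric d →
     ∃[ S ] (∀ s → T (S s) → Approximates α d (output s))
          × fromℚ (+ 2 / 3) ≤ Pr (final X) S

{-# OPTIONS --safe #-}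
-- Ambainis' weighted adversary argument.  Of the n points, m are centres, and
-- each of the other k ≥ m points (leaves) has a centre as its label,
-- arbitrarily; distances are 1 inside a cluster and D > α between clusters.
-- Relabelling one leaf changes its distances to the old and the new centre, so
-- no output is correct for both labellings, and the two final states are a
-- constant distance apart.  Hence Φ, the sum of the squared distances between
-- the states of a labelling and of its relabellings at one leaf, ends at order
-- k m per labelling.  A query separates a pair of states only on the queried
-- entries where the two metrics differ.  An entry at distance 1 is changed by
-- at most 2m relabellings and an entry at distance D by at most 2, so
-- weighting the two sides of AM-GM by 1 and m shows that a query increases Φ
-- by O(√ m) per labelling.  Hence q is of order at least k m / √ m ≥ m √ m.
module Submission where

open import Algebra.Bundles using (RawMonoid)
import Algebra.Definitions.RawMonoid as MonoidSum
open import Algebra.Structures using (IsCommutativeMonoid)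
open import Data.Bool using (Bool; true; false; if_then_else_; _xor_; T)
import Data.Bool.Properties as Bool
open import Data.Empty using (⊥; ⊥-elim)
open import Data.Fin using (Fin; zero; suc; fromℕ<; splitAt; _↑ˡ_; _↑ʳ_)
import Data.Fin.Properties as Fin
open import Data.Integer as ℤ using (+_; -[1+_])
import Data.Integer.Properties as ℤ
open import Data.Nat as ℕ using (ℕ; zero; suc; ⌊_/2⌋; ⌈_/2⌉)
import Data.Nat.Properties as ℕ
import Data.Nat.Solver as ℕ-Solver
open import Data.Product using (∃-syntax; _×_; _,_; proj₁; proj₂)
open import Data.Rational as ℚ using (ℚ; mkℚ; 0ℚ; 1ℚ; ½; _/_; ∣_∣)
import Data.Rational.Properties as ℚ
open import Data.Rational.Solver using (module +-*-Solver)
import Data.Rational.Unnormalised as ℚᵘ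
import Data.Rational.Unnormalised.Properties as ℚᵘ
open import Data.Sum using (_⊎_; inj₁; inj₂; [_,_]′)
open import Data.Unit using (tt)
open import Data.Vec using (Vec; []; _∷_; _[_]≔_; zipWith; lookup; replicate)
import Data.Vec.Properties as Vec
open import Function using (_∘_; id)
open import Level using (0ℓ)
open import Relation.Binary.Bundles using (Preorder)
open import Relation.Binary.Core using (Rel)
open import Relation.Binary.Definitions using (DecidableEquality)
open import Relation.Binary.PropositionalEquality
  using (_≡_; _≢_; refl; sym; trans; cong; cong₂; subst; subst₂)
open import Relation.Binary.PropositionalEquality.Properties using (isEquivalence)
open import Relation.Binary.Structures using (IsEquivalence; IsPartialOrder)
open import Relation.Nullary using (Dec; yes; no; does; contradiction)
open import Defs

-- Real numbers

-- The obstacle is the asymmetry of the two counts. With equal weights the entries at distance 1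
-- alone would decide: a query could add order m per labelling, and only order k queries would
-- follow. But where two metrics of a pair differ, exactly one of them has distance 1, so the
-- weights 1 and m always meet each other, with product m. Each side then pays at most 2m in total:
-- weight 1 up to 2m times, or weight m at most twice.
--
-- `Φ` is built from squared distances because they are sums over basis states: unitaries leave them
-- fixed, and a query can be estimated entry by entry. No real square root enters the estimate. A
-- natural `s` with s² at most m replaces √m, and `s ⋆ Φ` is tracked instead of `Φ`. Since all other
-- constants are naturals too, `Φ` can finally be eliminated and the outcome read off in ℕ.

IsNull : (ℕ → ℚ) → Set
IsNull u = ∀ ε → 0ℚ ℚ.< ε → ∃[ N ] (∀ n → N ℕ.≤ n → ∣ u n ∣ ℚ.≤ ε)

half-pos : ∀ {ε} → 0ℚ ℚ.< ε → 0ℚ ℚ.< ½ ℚ.* ε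
half-pos {ε} 0<ε = ℚ.positive⁻¹ (½ ℚ.* ε) {{ℚ.pos*pos⇒pos ½ ε {{ℚ.positive 0<ε}}}}

half+half : ∀ ε → ½ ℚ.* ε ℚ.+ ½ ℚ.* ε ≡ ε
half+half = solve 1 (λ e → con ½ :* e :+ con ½ :* e := e) refl
  where open +-*-Solver

-- `x ≈ y` unfolds to `IsNull` of the difference sequence. Equivalence and congruence laws thus
-- become rational identities fed through this lemma, plus closure properties of null sequences.
null-resp : ∀ {u v} → (∀ n → u n ≡ v n) → IsNull u → IsNull v
null-resp u≡v u→0 ε 0<ε with u→0 ε 0<ε
... | N , small = N , λ n N≤n → subst (λ q → ∣ q ∣ ℚ.≤ ε) (u≡v n) (small n N≤n)

null-0 : IsNull (λ _ → 0ℚ)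
null-0 ε 0<ε = 0 , λ _ _ → ℚ.<⇒≤ 0<ε

null-+ : ∀ {u v} → IsNull u → IsNull v → IsNull (λ n → u n ℚ.+ v n)
null-+ {u} {v} u→0 v→0 ε 0<ε with u→0 _ (half-pos 0<ε) | v→0 _ (half-pos 0<ε)
... | M , u-small | N , v-small = M ℕ.⊔ N , λ n ≤n →
  ℚ.≤-trans (ℚ.∣p+q∣≤∣p∣+∣q∣ (u n) (v n))
    (subst (∣ u n ∣ ℚ.+ ∣ v n ∣ ℚ.≤_) (half+half ε)
      (ℚ.+-mono-≤ (u-small n (ℕ.m⊔n≤o⇒m≤o M N ≤n)) (v-small n (ℕ.m⊔n≤o⇒n≤o M N ≤n))))

null-neg : ∀ {u} → IsNull u → IsNull (λ n → ℚ.- u n)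
null-neg {u} u→0 ε 0<ε with u→0 ε 0<ε
... | N , small = N , λ n N≤n → subst (ℚ._≤ ε) (sym (ℚ.∣-p∣≡∣p∣ (u n))) (small n N≤n)

p≤∣p∣ : ∀ p → p ℚ.≤ ∣ p ∣
p≤∣p∣ p with ℚ.∣p∣≡p∨∣p∣≡-p p
... | inj₁ eq = ℚ.≤-reflexive (sym eq)
... | inj₂ eq = ℚ.≤-trans
  (subst (ℚ._≤ 0ℚ) (trans (cong ℚ.-_ eq) (⁻¹-involutive p)) (ℚ.neg-antimono-≤ (ℚ.0≤∣p∣ p)))
  (ℚ.0≤∣p∣ p)
  where open import Algebra.Properties.Group ℚ.+-0-group using (⁻¹-involutive)

eventually-bounded : ∀ x → ∃[ B ] (0ℚ ℚ.< B × ∃[ N ] (∀ n → N ℕ.≤ n → ∣ seq x n ∣ ℚ.≤ B))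
eventually-bounded x with cauchy x 1ℚ (ℚ.positive⁻¹ 1ℚ)
... | N , close = 1ℚ ℚ.+ ∣ a ∣ , ℚ.+-mono-<-≤ (ℚ.positive⁻¹ 1ℚ) (ℚ.0≤∣p∣ a) , N , λ n N≤n →
  ℚ.≤-trans
    (subst (λ z → ∣ z ∣ ℚ.≤ ∣ seq x n ℚ.- a ∣ ℚ.+ ∣ a ∣)
      (solve 2 (λ u v → (u :- v) :+ v := u) refl (seq x n) a)
      (ℚ.∣p+q∣≤∣p∣+∣q∣ (seq x n ℚ.- a) a))
    (ℚ.+-monoˡ-≤ ∣ a ∣ (close n N N≤n ℕ.≤-refl))
  where
  open +-*-Solver
  a = seq x N

divide : ∀ {b ε} → 0ℚ ℚ.< b → 0ℚ ℚ.< ε → ∃[ δ ] (0ℚ ℚ.< δ × b ℚ.* δ ≡ ε)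
divide {b} {ε} 0<b 0<ε = 1/b ℚ.* ε
  , ℚ.positive⁻¹ (1/b ℚ.* ε) {{ℚ.pos*pos⇒pos 1/b {{ℚ.1/pos⇒pos b {{b⁺}}}} ε {{ℚ.positive 0<ε}}}}
  , trans (sym (ℚ.*-assoc b 1/b ε))
      (trans (cong (ℚ._* ε) (ℚ.*-inverseʳ b {{b≠0}})) (ℚ.*-identityˡ ε))
  where
  b⁺ = ℚ.positive 0<b
  b≠0 = ℚ.pos⇒nonZero b {{b⁺}}
  1/b = (ℚ.1/ b) {{b≠0}}

∣*∣-mono : ∀ p q {b d} → ∣ p ∣ ℚ.≤ b → ∣ q ∣ ℚ.≤ d → 0ℚ ℚ.≤ b → ∣ p ℚ.* q ∣ ℚ.≤ b ℚ.* d
∣*∣-mono p q {b} {d} p≤b q≤d 0≤b = ℚ.≤-trans (ℚ.≤-reflexive (ℚ.∣p*q∣≡∣p∣*∣q∣ p q)) (ℚ.≤-trans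
  (ℚ.*-monoʳ-≤-nonNeg ∣ q ∣ {{ℚ.nonNegative (ℚ.0≤∣p∣ q)}} p≤b)
  (ℚ.*-monoˡ-≤-nonNeg b {{ℚ.nonNegative 0≤b}} q≤d))

-- A Cauchy sequence is eventually bounded, and bounded times null is null.
null-* : ∀ x {u} → IsNull u → IsNull (λ n → seq x n ℚ.* u n)
null-* x {u} u→0 ε 0<ε =
  let B , 0<B , M , x≤B = eventually-bounded x
      δ , 0<δ , Bδ≡ε = divide {B} {ε} 0<B 0<ε
      N , small = u→0 δ 0<δ
  in M ℕ.⊔ N , λ n ≤n → subst (∣ seq x n ℚ.* u n ∣ ℚ.≤_) Bδ≡ε
       (∣*∣-mono (seq x n) (u n) (x≤B n (ℕ.m⊔n≤o⇒m≤o M N ≤n)) (small n (ℕ.m⊔n≤o⇒n≤o M N ≤n)) (ℚ.<⇒≤ 0<B))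

-- _≈_ and _≤_ unfold to quantified statements about sequences, from which
-- unification cannot recover the two reals; the record wrappers can be inverted.

infix 4 _≃_ _≼_

record _≃_ (x y : ℝ) : Set where
  constructor wrap
  field unwrap : x ≈ y

record _≼_ (x y : ℝ) : Set where
  constructor wrap
  field unwrap : x ≤ y

pointwise-≃ : ∀ {x y} → (∀ n → seq x n ≡ seq y n) → x ≃ y
pointwise-≃ {x} {y} x≡y = wrap (null-resp
  (λ n → sym (trans (cong (ℚ._- seq y n) (x≡y n)) (ℚ.+-inverseʳ (seq y n)))) null-0)

pointwise-≼ : ∀ {x y} → (∀ n → seq x n ℚ.≤ seq y n) → x ≼ y
pointwise-≼ {x} {y} x≤y = wrap λ ε 0<ε → 0 , λ n _ →
  ℚ.≤-trans (x≤y n) (subst (ℚ._≤ seq y n ℚ.+ ε) (ℚ.+-identityʳ (seq y n))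
    (ℚ.+-monoʳ-≤ (seq y n) (ℚ.<⇒≤ 0<ε)))

≃-refl : ∀ {x} → x ≃ x
≃-refl = pointwise-≃ λ _ → refl

≃-sym : ∀ {x y} → x ≃ y → y ≃ x
≃-sym {x} {y} (wrap x≈y) = wrap (null-resp (λ n → flip (seq x n) (seq y n)) (null-neg x≈y))
  where
  open +-*-Solver
  flip : ∀ a b → ℚ.- (a ℚ.- b) ≡ b ℚ.- a
  flip = solve 2 (λ a b → :- (a :- b) := b :- a) refl

≃-trans : ∀ {x y z} → x ≃ y → y ≃ z → x ≃ z
≃-trans {x} {y} {z} (wrap x≈y) (wrap y≈z) =
  wrap (null-resp (λ n → telescope (seq x n) (seq y n) (seq z n)) (null-+ x≈y y≈z))
  where
  open +-*-Solver
  telescope : ∀ a b c → (a ℚ.- b) ℚ.+ (b ℚ.- c) ≡ a ℚ.- c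
  telescope = solve 3 (λ a b c → (a :- b) :+ (b :- c) := a :- c) refl

≃-isEquivalence : IsEquivalence _≃_
≃-isEquivalence = record { refl = ≃-refl ; sym = ≃-sym ; trans = ≃-trans }

≃-reflexive : ∀ {x y} → x ≡ y → x ≃ y
≃-reflexive = IsEquivalence.reflexive ≃-isEquivalence

+-cong : ∀ {x x′ y y′} → x ≃ x′ → y ≃ y′ → x + y ≃ x′ + y′
+-cong {x} {x′} {y} {y′} (wrap x≈) (wrap y≈) = wrap (null-resp
  (λ n → regroup (seq x n) (seq x′ n) (seq y n) (seq y′ n)) (null-+ x≈ y≈))
  where
  open +-*-Solver
  regroup : ∀ a b c d → (a ℚ.- b) ℚ.+ (c ℚ.- d) ≡ (a ℚ.+ c) ℚ.- (b ℚ.+ d)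
  regroup = solve 4 (λ a b c d → (a :- b) :+ (c :- d) := (a :+ c) :- (b :+ d)) refl

neg-cong : ∀ {x x′} → x ≃ x′ → - x ≃ - x′
neg-cong {x} {x′} (wrap x≈) = wrap (null-resp (λ n → regroup (seq x n) (seq x′ n)) (null-neg x≈))
  where
  open +-*-Solver
  regroup : ∀ a b → ℚ.- (a ℚ.- b) ≡ ℚ.- a ℚ.- ℚ.- b
  regroup = solve 2 (λ a b → :- (a :- b) := :- a :- :- b) refl

*-cong : ∀ {x x′ y y′} → x ≃ x′ → y ≃ y′ → x * y ≃ x′ * y′
*-cong {x} {x′} {y} {y′} (wrap x≈) (wrap y≈) = wrap (null-resp
  (λ n → regroup (seq x n) (seq x′ n) (seq y n) (seq y′ n)) (null-+ (null-* x y≈) (null-* y′ x≈)))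
  where
  open +-*-Solver
  regroup : ∀ a b c d → a ℚ.* (c ℚ.- d) ℚ.+ d ℚ.* (a ℚ.- b) ≡ a ℚ.* c ℚ.- b ℚ.* d
  regroup = solve 4 (λ a b c d → a :* (c :- d) :+ d :* (a :- b) := a :* c :- b :* d) refl

+-0-isCommutativeMonoid : IsCommutativeMonoid _≃_ _+_ 0ℝ
+-0-isCommutativeMonoid = record
  { isMonoid = record
    { isSemigroup = record
      { isMagma = record { isEquivalence = ≃-isEquivalence ; ∙-cong = +-cong }
      ; assoc = λ x y z → pointwise-≃ λ n → ℚ.+-assoc (seq x n) (seq y n) (seq z n)
      }
    ; identity = (λ x → pointwise-≃ λ n → ℚ.+-identityˡ (seq x n))
               , (λ x → pointwise-≃ λ n → ℚ.+-identityʳ (seq x n))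
    }
  ; comm = λ x y → pointwise-≃ λ n → ℚ.+-comm (seq x n) (seq y n)
  }

open IsCommutativeMonoid +-0-isCommutativeMonoid public using ()
  renaming (assoc to +-assoc; comm to +-comm; identityˡ to +-identityˡ; identityʳ to +-identityʳ)

*-zeroʳ : ∀ x → x * 0ℝ ≃ 0ℝ
*-zeroʳ x = pointwise-≃ λ n → ℚ.*-zeroʳ (seq x n)

*-zeroˡ : ∀ x → 0ℝ * x ≃ 0ℝ
*-zeroˡ x = pointwise-≃ λ n → ℚ.*-zeroˡ (seq x n)

*-identityˡ : ∀ x → 1ℝ * x ≃ x
*-identityˡ x = pointwise-≃ λ n → ℚ.*-identityˡ (seq x n)

*-identityʳ : ∀ x → x * 1ℝ ≃ x
*-identityʳ x = pointwise-≃ λ n → ℚ.*-identityʳ (seq x n)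

*-assoc : ∀ x y z → x * y * z ≃ x * (y * z)
*-assoc x y z = pointwise-≃ λ n → ℚ.*-assoc (seq x n) (seq y n) (seq z n)

*-comm : ∀ x y → x * y ≃ y * x
*-comm x y = pointwise-≃ λ n → ℚ.*-comm (seq x n) (seq y n)

*-distribˡ-+ : ∀ x y z → x * (y + z) ≃ x * y + x * z
*-distribˡ-+ x y z = pointwise-≃ λ n → ℚ.*-distribˡ-+ (seq x n) (seq y n) (seq z n)

*-distribʳ-+ : ∀ x y z → (y + z) * x ≃ y * x + z * x
*-distribʳ-+ x y z = pointwise-≃ λ n → ℚ.*-distribʳ-+ (seq x n) (seq y n) (seq z n)

≃⇒≼ : ∀ {x y} → x ≃ y → x ≼ y
≃⇒≼ {x} {y} (wrap x≈y) = wrap λ ε 0<ε → let N , small = x≈y ε 0<ε in N , λ n N≤n →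
  subst₂ ℚ._≤_ (cancel (seq y n) (seq x n)) refl
    (ℚ.+-monoʳ-≤ (seq y n) (ℚ.≤-trans (p≤∣p∣ (seq x n ℚ.- seq y n)) (small n N≤n)))
  where
  open +-*-Solver
  cancel : ∀ b a → b ℚ.+ (a ℚ.- b) ≡ a
  cancel = solve 2 (λ b a → b :+ (a :- b) := a) refl

≼-refl : ∀ {x} → x ≼ x
≼-refl = ≃⇒≼ ≃-refl

≼-trans : ∀ {x y z} → x ≼ y → y ≼ z → x ≼ z
≼-trans {x} {y} {z} (wrap x≤y) (wrap y≤z) = wrap λ ε 0<ε →
  let M , below = x≤y _ (half-pos 0<ε)
      N , above = y≤z _ (half-pos 0<ε)
  in M ℕ.⊔ N , λ n ≤n → begin
    seq x n                                    ≤⟨ below n (ℕ.m⊔n≤o⇒m≤o M N ≤n) ⟩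
    seq y n ℚ.+ ½ ℚ.* ε                        ≤⟨ ℚ.+-monoˡ-≤ (½ ℚ.* ε) (above n (ℕ.m⊔n≤o⇒n≤o M N ≤n)) ⟩
    seq z n ℚ.+ ½ ℚ.* ε ℚ.+ ½ ℚ.* ε            ≡⟨ ℚ.+-assoc (seq z n) (½ ℚ.* ε) (½ ℚ.* ε) ⟩
    seq z n ℚ.+ (½ ℚ.* ε ℚ.+ ½ ℚ.* ε)          ≡⟨ cong (seq z n ℚ.+_) (half+half ε) ⟩
    seq z n ℚ.+ ε                              ∎
  where open ℚ.≤-Reasoning

≼-antisym : ∀ {x y} → x ≼ y → y ≼ x → x ≃ y
≼-antisym {x} {y} (wrap x≤y) (wrap y≤x) = wrap λ ε 0<ε →
  let M , below = x≤y ε 0<ε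
      N , above = y≤x ε 0<ε
  in M ℕ.⊔ N , λ n ≤n → within (below n (ℕ.m⊔n≤o⇒m≤o M N ≤n)) (above n (ℕ.m⊔n≤o⇒n≤o M N ≤n))
  where
  open +-*-Solver
  cancel : ∀ b e → (b ℚ.+ e) ℚ.- b ≡ e
  cancel = solve 2 (λ b e → (b :+ e) :- b := e) refl
  flip : ∀ a b → b ℚ.- a ≡ ℚ.- (a ℚ.- b)
  flip = solve 2 (λ a b → b :- a := :- (a :- b)) refl
  within : ∀ {a b ε} → a ℚ.≤ b ℚ.+ ε → b ℚ.≤ a ℚ.+ ε → ∣ a ℚ.- b ∣ ℚ.≤ ε
  within {a} {b} {ε} a≤ b≤ with ℚ.∣p∣≡p∨∣p∣≡-p (a ℚ.- b)
  ... | inj₁ eq = subst₂ ℚ._≤_ (sym eq) (cancel b ε) (ℚ.+-monoˡ-≤ (ℚ.- b) a≤)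
  ... | inj₂ eq = subst₂ ℚ._≤_ (trans (flip a b) (sym eq)) (cancel a ε) (ℚ.+-monoˡ-≤ (ℚ.- a) b≤)

≼-preorder : Preorder 0ℓ 0ℓ 0ℓ
≼-preorder = record
  { Carrier = ℝ ; _≈_ = _≃_ ; _≲_ = _≼_
  ; isPreorder = record { isEquivalence = ≃-isEquivalence ; reflexive = ≃⇒≼ ; trans = ≼-trans } }

module ≼-Reasoning where
  open import Relation.Binary.Reasoning.Preorder ≼-preorder public

+-mono-≼ : ∀ {x x′ y y′} → x ≼ x′ → y ≼ y′ → x + y ≼ x′ + y′
+-mono-≼ {x} {x′} {y} {y′} (wrap x≤) (wrap y≤) = wrap λ ε 0<ε →
  let M , below = x≤ _ (half-pos 0<ε)
      N , above = y≤ _ (half-pos 0<ε)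
  in M ℕ.⊔ N , λ n ≤n → subst (seq x n ℚ.+ seq y n ℚ.≤_)
    (trans (regroup (seq x′ n) (seq y′ n) (½ ℚ.* ε) (½ ℚ.* ε))
      (cong (seq x′ n ℚ.+ seq y′ n ℚ.+_) (half+half ε)))
    (ℚ.+-mono-≤ (below n (ℕ.m⊔n≤o⇒m≤o M N ≤n)) (above n (ℕ.m⊔n≤o⇒n≤o M N ≤n)))
  where
  open +-*-Solver
  regroup : ∀ a b c d → (a ℚ.+ c) ℚ.+ (b ℚ.+ d) ≡ (a ℚ.+ b) ℚ.+ (c ℚ.+ d)
  regroup = solve 4 (λ a b c d → (a :+ c) :+ (b :+ d) := (a :+ b) :+ (c :+ d)) refl

+-cancelʳ-≼ : ∀ z {x y} → x + z ≼ y + z → x ≼ y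
+-cancelʳ-≼ z {x} {y} le = begin
  x              ≈⟨ pointwise-≃ (λ n → undo (seq x n) (seq z n)) ⟩
  x + z + - z    ≲⟨ +-mono-≼ le ≼-refl ⟩
  y + z + - z    ≈⟨ pointwise-≃ (λ n → undo (seq y n) (seq z n)) ⟨
  y              ∎
  where
  open ≼-Reasoning
  open +-*-Solver
  undo : ∀ a b → a ≡ a ℚ.+ b ℚ.+ ℚ.- b
  undo = solve 2 (λ a b → a := a :+ b :+ :- b) refl

-- Natural multiples

/1-homo-+ : ∀ a b → + (a ℕ.+ b) / 1 ≡ + a / 1 ℚ.+ + b / 1
/1-homo-+ a b = ℚ.toℚᵘ-injective (begin
  ℚ.toℚᵘ (+ (a ℕ.+ b) / 1)                    ≈⟨ ℚ.toℚᵘ-fromℚᵘ (ℚᵘ.mkℚᵘ (+ (a ℕ.+ b)) 0) ⟩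
  ℚᵘ.mkℚᵘ (+ (a ℕ.+ b)) 0                     ≈⟨ ℚᵘ.*≡* (cong (ℤ._* + 1) (sym (cong₂ ℤ._+_ (ℤ.*-identityʳ (+ a)) (ℤ.*-identityʳ (+ b))))) ⟩
  ℚᵘ.mkℚᵘ (+ a) 0 ℚᵘ.+ ℚᵘ.mkℚᵘ (+ b) 0        ≈⟨ ℚᵘ.+-cong (ℚ.toℚᵘ-fromℚᵘ (ℚᵘ.mkℚᵘ (+ a) 0)) (ℚ.toℚᵘ-fromℚᵘ (ℚᵘ.mkℚᵘ (+ b) 0)) ⟨
  ℚ.toℚᵘ (+ a / 1) ℚᵘ.+ ℚ.toℚᵘ (+ b / 1)      ≈⟨ ℚ.toℚᵘ-homo-+ (+ a / 1) (+ b / 1) ⟨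
  ℚ.toℚᵘ (+ a / 1 ℚ.+ + b / 1)                ∎)
  where open import Relation.Binary.Reasoning.Setoid ℚᵘ.≃-setoid

/1-homo-* : ∀ a b → + (a ℕ.* b) / 1 ≡ + a / 1 ℚ.* (+ b / 1)
/1-homo-* a b = ℚ.toℚᵘ-injective (begin
  ℚ.toℚᵘ (+ (a ℕ.* b) / 1)                    ≈⟨ ℚ.toℚᵘ-fromℚᵘ (ℚᵘ.mkℚᵘ (+ (a ℕ.* b)) 0) ⟩
  ℚᵘ.mkℚᵘ (+ (a ℕ.* b)) 0                     ≈⟨ ℚᵘ.*≡* (cong (ℤ._* + 1) (ℤ.pos-* a b)) ⟩
  ℚᵘ.mkℚᵘ (+ a) 0 ℚᵘ.* ℚᵘ.mkℚᵘ (+ b) 0        ≈⟨ ℚᵘ.*-cong (ℚ.toℚᵘ-fromℚᵘ (ℚᵘ.mkℚᵘ (+ a) 0)) (ℚ.toℚᵘ-fromℚᵘ (ℚᵘ.mkℚᵘ (+ b) 0)) ⟨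
  ℚ.toℚᵘ (+ a / 1) ℚᵘ.* ℚ.toℚᵘ (+ b / 1)      ≈⟨ ℚ.toℚᵘ-homo-* (+ a / 1) (+ b / 1) ⟨
  ℚ.toℚᵘ (+ a / 1 ℚ.* (+ b / 1))              ∎)
  where open import Relation.Binary.Reasoning.Setoid ℚᵘ.≃-setoid

/1-mono-≤ : ∀ {a b} → a ℕ.≤ b → + a / 1 ℚ.≤ + b / 1
/1-mono-≤ {a} {b} a≤b = ℚ.toℚᵘ-cancel-≤
  (ℚᵘ.≤-respˡ-≃ (ℚᵘ.≃-sym (ℚ.toℚᵘ-fromℚᵘ (ℚᵘ.mkℚᵘ (+ a) 0)))
    (ℚᵘ.≤-respʳ-≃ (ℚᵘ.≃-sym (ℚ.toℚᵘ-fromℚᵘ (ℚᵘ.mkℚᵘ (+ b) 0)))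
      (ℚᵘ.*≤* (ℤ.*-monoʳ-≤-nonNeg (+ 1) (ℤ.+≤+ a≤b)))))

fromℕ-+ : ∀ a b → fromℕ (a ℕ.+ b) ≃ fromℕ a + fromℕ b
fromℕ-+ a b = pointwise-≃ λ _ → /1-homo-+ a b

fromℕ-* : ∀ a b → fromℕ (a ℕ.* b) ≃ fromℕ a * fromℕ b
fromℕ-* a b = pointwise-≃ λ _ → /1-homo-* a b

fromℕ-mono : ∀ {a b} → a ℕ.≤ b → fromℕ a ≼ fromℕ b
fromℕ-mono a≤b = pointwise-≼ λ _ → /1-mono-≤ a≤b

-- Naturals are 1 apart, so the real inequality at the tolerance ½ already settles the matter. This
-- is the exit from the reals for the whole counting argument.
fromℕ-cancel : ∀ {a b} → fromℕ a ≼ fromℕ b → a ℕ.≤ b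
fromℕ-cancel {a} {b} (wrap a≤b) with a ℕ.≤? b | a≤b ½ (ℚ.positive⁻¹ ½)
... | yes le | _ = le
... | no  ≰  | N , le = contradiction
  (ℚ.<-≤-trans
    (subst (+ b / 1 ℚ.+ ½ ℚ.<_)
      (trans (sym (/1-homo-+ b 1)) (cong (λ c → + c / 1) (ℕ.+-comm b 1)))
      (ℚ.+-monoʳ-< (+ b / 1) (ℚ.*<* (ℤ.+<+ (ℕ.s≤s (ℕ.s≤s ℕ.z≤n))))))
    (ℚ.≤-trans (/1-mono-≤ (ℕ.≰⇒> ≰)) (le N ℕ.≤-refl)))
  (ℚ.<-irrefl refl)

fromℕ-injective : ∀ {a b} → fromℕ a ≃ fromℕ b → a ≡ b
fromℕ-injective a≃b = ℕ.≤-antisym (fromℕ-cancel (≃⇒≼ a≃b)) (fromℕ-cancel (≃⇒≼ (≃-sym a≃b)))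

infixr 7 _⋆_

-- With natural multipliers, monotonicity follows from additivity by induction, without a theory of
-- products of nonnegative reals. Inequalities below are stated with denominators cleared
-- accordingly.
_⋆_ : ℕ → ℝ → ℝ
a ⋆ x = fromℕ a * x

⋆-cong : ∀ a {x y} → x ≃ y → a ⋆ x ≃ a ⋆ y
⋆-cong a = *-cong (≃-refl {fromℕ a})

⋆-zeroˡ : ∀ x → 0 ⋆ x ≃ 0ℝ
⋆-zeroˡ = *-zeroˡ

⋆-zeroʳ : ∀ a → a ⋆ 0ℝ ≃ 0ℝ
⋆-zeroʳ a = *-zeroʳ (fromℕ a)

⋆-distribʳ : ∀ x a b → (a ℕ.+ b) ⋆ x ≃ a ⋆ x + b ⋆ x
⋆-distribʳ x a b = ≃-trans (*-cong (fromℕ-+ a b) ≃-refl) (*-distribʳ-+ x (fromℕ a) (fromℕ b))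

⋆-distribˡ : ∀ a x y → a ⋆ (x + y) ≃ a ⋆ x + a ⋆ y
⋆-distribˡ a = *-distribˡ-+ (fromℕ a)

⋆-assoc : ∀ a b x → (a ℕ.* b) ⋆ x ≃ a ⋆ b ⋆ x
⋆-assoc a b x = ≃-trans (*-cong (fromℕ-* a b) ≃-refl) (*-assoc (fromℕ a) (fromℕ b) x)

⋆-suc : ∀ a x → suc a ⋆ x ≃ x + a ⋆ x
⋆-suc a x = ≃-trans (⋆-distribʳ x 1 a) (+-cong (*-identityˡ x) ≃-refl)

⋆-monoʳ-≼ : ∀ a {x y} → x ≼ y → a ⋆ x ≼ a ⋆ y
⋆-monoʳ-≼ zero {x} {y} _ = ≃⇒≼ (≃-trans (⋆-zeroˡ x) (≃-sym (⋆-zeroˡ y)))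
⋆-monoʳ-≼ (suc a) {x} {y} x≼y = begin
  suc a ⋆ x    ≈⟨ ⋆-suc a x ⟩
  x + a ⋆ x    ≲⟨ +-mono-≼ x≼y (⋆-monoʳ-≼ a x≼y) ⟩
  y + a ⋆ y    ≈⟨ ⋆-suc a y ⟨
  suc a ⋆ y    ∎
  where open ≼-Reasoning

⋆-nonneg : ∀ a {x} → 0ℝ ≼ x → 0ℝ ≼ a ⋆ x
⋆-nonneg a 0≼x = ≼-trans (≃⇒≼ (≃-sym (⋆-zeroʳ a))) (⋆-monoʳ-≼ a 0≼x)

⋆-monoˡ-≼ : ∀ {a b x} → 0ℝ ≼ x → a ℕ.≤ b → a ⋆ x ≼ b ⋆ x
⋆-monoˡ-≼ {a} {b} {x} 0≼x a≤b = begin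
  a ⋆ x                    ≈⟨ +-identityʳ (a ⋆ x) ⟨
  a ⋆ x + 0ℝ               ≲⟨ +-mono-≼ ≼-refl (⋆-nonneg (b ℕ.∸ a) 0≼x) ⟩
  a ⋆ x + (b ℕ.∸ a) ⋆ x    ≈⟨ ⋆-distribʳ x a (b ℕ.∸ a) ⟨
  (a ℕ.+ (b ℕ.∸ a)) ⋆ x    ≡⟨ cong (_⋆ x) (ℕ.m+[n∸m]≡n a≤b) ⟩
  b ⋆ x                    ∎
  where open ≼-Reasoning

≤-∣numerator∣ : ∀ q → q ℚ.≤ + ℤ.∣ ℚ.numerator q ∣ / 1
≤-∣numerator∣ q@(mkℚ n d _) = ℚ.toℚᵘ-cancel-≤
  (ℚᵘ.≤-respʳ-≃ (ℚᵘ.≃-sym (ℚ.toℚᵘ-fromℚᵘ (ℚᵘ.mkℚᵘ (+ ℤ.∣ n ∣) 0)))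
    (ℚᵘ.*≤* (ℤ.≤-trans (ℤ.≤-reflexive (ℤ.*-identityʳ n)) (ℤ.≤-trans (≤∣∣ n)
      (ℤ.≤-trans (ℤ.+≤+ (ℕ.m≤m*n ℤ.∣ n ∣ (suc d))) (ℤ.≤-reflexive (ℤ.pos-* ℤ.∣ n ∣ (suc d))))))))
  where
  ≤∣∣ : ∀ i → i ℤ.≤ + ℤ.∣ i ∣
  ≤∣∣ (+ _)    = ℤ.≤-refl
  ≤∣∣ -[1+ _ ] = ℤ.-≤+

-- `α` is an arbitrary real, while the distance between clusters has to be a natural number beyond
-- it.
bounded-by-ℕ : ∀ x → ∃[ B ] (x ≼ fromℕ B)
bounded-by-ℕ x =
  let B , _ , N , x≤B = eventually-bounded x
  in ℤ.∣ ℚ.numerator B ∣ , wrap λ ε 0<ε → N , λ k N≤k →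
    subst (ℚ._≤ + ℤ.∣ ℚ.numerator B ∣ / 1 ℚ.+ ε) (ℚ.+-identityʳ (seq x k))
      (ℚ.+-mono-≤ (ℚ.≤-trans (p≤∣p∣ (seq x k)) (ℚ.≤-trans (x≤B k N≤k) (≤-∣numerator∣ B)))
        (ℚ.<⇒≤ 0<ε))

square-nonneg : ∀ q → 0ℚ ℚ.≤ q ℚ.* q
square-nonneg q with ℚ.≤-total 0ℚ q
... | inj₁ 0≤q = ℚ.nonNegative⁻¹ (q ℚ.* q) {{ℚ.nonNeg*nonNeg⇒nonNeg q {{0≤}} q {{0≤}}}}
  where 0≤ = ℚ.nonNegative 0≤q
... | inj₂ q≤0 = subst (ℚ._≤ q ℚ.* q) (ℚ.*-zeroˡ q)
  (ℚ.*-monoʳ-≤-nonPos q {{ℚ.nonPositive q≤0}} q≤0)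

-- Finite sums

-- total-rel says that summation is parametric in the monoid.  Congruence,
-- monotonicity, compatibility with homomorphisms and (through function
-- monoids) interchange of sums are all instances of it.
record Summation (A : Set) : Set₁ where
  open RawMonoid using (Carrier; ε)
  field
    total : (M : RawMonoid 0ℓ 0ℓ) → (A → Carrier M) → Carrier M

    total-rel : ∀ M N (R : Carrier M → Carrier N → Set) → R (ε M) (ε N) →
      (∀ {x y u v} → R x y → R u v → R (RawMonoid._∙_ M x u) (RawMonoid._∙_ N y v)) →
      ∀ {f g} → (∀ a → R (f a) (g a)) → R (total M f) (total N g)

    -- Parametricity does not say that every index is summed exactly once; this field does.
    total-single : ∀ M {_~_ : Rel (Carrier M) 0ℓ} →
      IsCommutativeMonoid _~_ (RawMonoid._∙_ M) (ε M) →
      ∀ a f → (∀ b → b ≢ a → f b ~ ε M) → total M f ~ f a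

open Summation

fin : ∀ n → Summation (Fin n)
fin n = record
  { total        = λ M → MonoidSum.sum M
  ; total-rel    = λ M N R Rε R∙ → rel M N R Rε R∙ n
  ; total-single = λ M isCM → single M isCM n
  }
  where
  rel : ∀ M N (R : RawMonoid.Carrier M → RawMonoid.Carrier N → Set) → R (RawMonoid.ε M) (RawMonoid.ε N) →
    (∀ {x y u v} → R x y → R u v → R (RawMonoid._∙_ M x u) (RawMonoid._∙_ N y v)) →
    ∀ n {f g} → (∀ (i : Fin n) → R (f i) (g i)) → R (MonoidSum.sum M f) (MonoidSum.sum N g)
  rel M N R Rε R∙ zero    Rfg = Rε
  rel M N R Rε R∙ (suc n) Rfg = R∙ (Rfg zero) (rel M N R Rε R∙ n (Rfg ∘ suc))

  module _ (M : RawMonoid 0ℓ 0ℓ) {_~_ : Rel (RawMonoid.Carrier M) 0ℓ}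
           (isCM : IsCommutativeMonoid _~_ (RawMonoid._∙_ M) (RawMonoid.ε M)) where
    open RawMonoid M using (ε)
    open IsCommutativeMonoid isCM using (∙-cong; identityˡ; identityʳ)
      renaming (refl to ~refl; trans to ~trans)

    vanishes : ∀ n f → (∀ (i : Fin n) → f i ~ ε) → MonoidSum.sum M f ~ ε
    vanishes zero    f f~ε = ~refl
    vanishes (suc n) f f~ε = ~trans (∙-cong (f~ε zero) (vanishes n (f ∘ suc) (f~ε ∘ suc))) (identityˡ ε)

    single : ∀ n (i : Fin n) f → (∀ j → j ≢ i → f j ~ ε) → MonoidSum.sum M f ~ f i
    single (suc n) zero f f~ε =
      ~trans (∙-cong ~refl (vanishes n (f ∘ suc) λ j → f~ε (suc j) λ ())) (identityʳ (f zero))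
    single (suc n) (suc i) f f~ε =
      ~trans (∙-cong (f~ε zero λ ()) (single n i (f ∘ suc) λ j j≢i → f~ε (suc j) λ { refl → j≢i refl }))
        (identityˡ (f (suc i)))

infixr 4 _⊗_

_⊗_ : ∀ {A B} → Summation A → Summation B → Summation (A × B)
S ⊗ T = record
  { total        = λ M f → total S M λ a → total T M λ b → f (a , b)
  ; total-rel    = λ M N R Rε R∙ Rfg →
      total-rel S M N R Rε R∙ λ a → total-rel T M N R Rε R∙ λ b → Rfg (a , b)
  ; total-single = λ { M {_~_} isCM (a , b) f f~ε →
      let open IsCommutativeMonoid isCM renaming (refl to ~refl; trans to ~trans)
          ε = RawMonoid.ε M
      in ~trans
        (total-single S M isCM a _ λ a′ a′≢a →
          total-rel T M M (λ x _ → x ~ ε) ~refl (λ x~ y~ → ~trans (∙-cong x~ y~) (identityˡ ε))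
            {g = λ _ → ε} λ b′ → f~ε (a′ , b′) λ { refl → a′≢a refl })
        (total-single T M isCM b _ λ b′ b′≢b → f~ε (a , b′) λ { refl → b′≢b refl }) }
  }

boolean : Summation Bool
boolean = record
  { total        = λ M f → RawMonoid._∙_ M (f false) (f true)
  ; total-rel    = λ M N R Rε R∙ Rfg → R∙ (Rfg false) (Rfg true)
  ; total-single = λ
    { M isCM false f f~ε → let open IsCommutativeMonoid isCM renaming (refl to ~refl; trans to ~trans) in
        ~trans (∙-cong ~refl (f~ε true λ ())) (identityʳ (f false))
    ; M isCM true f f~ε → let open IsCommutativeMonoid isCM renaming (refl to ~refl; trans to ~trans) in
        ~trans (∙-cong (f~ε false λ ()) ~refl) (identityˡ (f true)) }
  }

vec : ∀ {A} → Summation A → ∀ k → Summation (Vec A k)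
vec {A} S k = record
  { total        = λ M → vecTotal M k
  ; total-rel    = λ M N R Rε R∙ → rel M N R Rε R∙ k
  ; total-single = λ M isCM → single M isCM k
  }
  where
  vecTotal : ∀ M k → (Vec A k → RawMonoid.Carrier M) → RawMonoid.Carrier M
  vecTotal M zero    f = f []
  vecTotal M (suc k) f = total S M λ a → vecTotal M k (f ∘ (a ∷_))

  rel : ∀ M N (R : RawMonoid.Carrier M → RawMonoid.Carrier N → Set) → R (RawMonoid.ε M) (RawMonoid.ε N) →
    (∀ {x y u v} → R x y → R u v → R (RawMonoid._∙_ M x u) (RawMonoid._∙_ N y v)) →
    ∀ k {f g} → (∀ (v : Vec A k) → R (f v) (g v)) → R (vecTotal M k f) (vecTotal N k g)
  rel M N R Rε R∙ zero    Rfg = Rfg []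
  rel M N R Rε R∙ (suc k) Rfg = total-rel S M N R Rε R∙ λ a → rel M N R Rε R∙ k λ v → Rfg (a ∷ v)

  module _ (M : RawMonoid 0ℓ 0ℓ) {_~_ : Rel (RawMonoid.Carrier M) 0ℓ}
           (isCM : IsCommutativeMonoid _~_ (RawMonoid._∙_ M) (RawMonoid.ε M)) where
    open RawMonoid M using (ε)
    open IsCommutativeMonoid isCM using (∙-cong; identityˡ)
      renaming (refl to ~refl; trans to ~trans)

    single : ∀ k (v : Vec A k) f → (∀ w → w ≢ v → f w ~ ε) → vecTotal M k f ~ f v
    single zero    []      f f~ε = ~refl
    single (suc k) (a ∷ v) f f~ε = ~trans
      (total-single S M isCM a _ λ a′ a′≢a →
        rel M M (λ x _ → x ~ ε) ~refl (λ x~ y~ → ~trans (∙-cong x~ y~) (identityˡ ε)) k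
          {g = λ _ → ε} λ w → f~ε (a′ ∷ w) λ { refl → a′≢a refl })
      (single k v (f ∘ (a ∷_)) λ w w≢v → f~ε (a ∷ w) λ { refl → w≢v refl })

-- vec boolean b sums in the same way, but only sumBits makes basis below
-- definitionally equal to sumBasis.
bitstrings : ∀ b → Summation (Vec Bool b)
bitstrings b = record
  { total        = λ M → BasisSum.sumBits M
  ; total-rel    = λ M N R Rε R∙ {f} {g} Rfg →
      subst₂ R (sym (sumBits≡ M b f)) (sym (sumBits≡ N b g)) (total-rel (vec boolean b) M N R Rε R∙ Rfg)
  ; total-single = λ M {_~_} isCM v f f~ε →
      subst (λ x → x ~ f v) (sym (sumBits≡ M b f)) (total-single (vec boolean b) M isCM v f f~ε)
  }
  where
  sumBits≡ : ∀ M b f → BasisSum.sumBits M {b} f ≡ total (vec boolean b) M f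
  sumBits≡ M zero    f = refl
  sumBits≡ M (suc b) f = cong₂ (RawMonoid._∙_ M) (sumBits≡ M b _) (sumBits≡ M b _)

basis : ∀ n b w → Summation (Basis n b w)
basis n b w = fin n ⊗ fin n ⊗ bitstrings b ⊗ fin w

module SumProperties (M : RawMonoid 0ℓ 0ℓ) (_~_ : Rel (RawMonoid.Carrier M) 0ℓ)
  (isCM : IsCommutativeMonoid _~_ (RawMonoid._∙_ M) (RawMonoid.ε M)) where

  open RawMonoid M using (Carrier; _∙_; ε)
  open IsCommutativeMonoid isCM using (∙-cong; identityˡ; identityʳ; assoc; comm; setoid)
    renaming (refl to ~refl; sym to ~sym; trans to ~trans)

  interchange : ∀ a b c d → ((a ∙ b) ∙ (c ∙ d)) ~ ((a ∙ c) ∙ (b ∙ d))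
  interchange a b c d = begin
    (a ∙ b) ∙ (c ∙ d)    ≈⟨ assoc a b (c ∙ d) ⟩
    a ∙ (b ∙ (c ∙ d))    ≈⟨ ∙-cong ~refl (assoc b c d) ⟨
    a ∙ ((b ∙ c) ∙ d)    ≈⟨ ∙-cong ~refl (∙-cong (comm b c) ~refl) ⟩
    a ∙ ((c ∙ b) ∙ d)    ≈⟨ ∙-cong ~refl (assoc c b d) ⟩
    a ∙ (c ∙ (b ∙ d))    ≈⟨ assoc a c (b ∙ d) ⟨
    (a ∙ c) ∙ (b ∙ d)    ∎
    where open import Relation.Binary.Reasoning.Setoid setoid

  module _ {A : Set} (S : Summation A) where

    total-cong : ∀ {f g} → (∀ a → f a ~ g a) → total S M f ~ total S M g
    total-cong = total-rel S M M _~_ ~refl ∙-cong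

    total-ε : total S M (λ _ → ε) ~ ε
    total-ε = total-rel S M M (λ x _ → x ~ ε) ~refl
      (λ x~ y~ → ~trans (∙-cong x~ y~) (identityˡ ε)) {g = λ _ → ε} λ _ → ~refl

    -- One sum in the product monoid carries both totals. Relating it to `M` by each projection, and
    -- by the product of the components, gives the three sums in question.
    total-∙ : ∀ f g → total S M (λ a → f a ∙ g a) ~ (total S M f ∙ total S M g)
    total-∙ f g = ~trans (~sym combined) (∙-cong left right)
      where
      M² : RawMonoid 0ℓ 0ℓ
      M² = record
        { Carrier = Carrier × Carrier ; _≈_ = _≡_
        ; _∙_ = λ { (x , y) (u , v) → x ∙ u , y ∙ v } ; ε = ε , ε }
      fg = total S M² (λ a → f a , g a)
      combined : (proj₁ fg ∙ proj₂ fg) ~ total S M (λ a → f a ∙ g a)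
      combined = total-rel S M² M (λ { (x , y) z → (x ∙ y) ~ z }) (identityˡ ε)
        (λ { {x , y} {_} {u , v} xy uv → ~trans (interchange x u y v) (∙-cong xy uv) }) λ _ → ~refl
      left : proj₁ fg ~ total S M f
      left = total-rel S M² M (λ p z → proj₁ p ~ z) ~refl ∙-cong λ _ → ~refl
      right : proj₂ fg ~ total S M g
      right = total-rel S M² M (λ p z → proj₂ p ~ z) ~refl ∙-cong λ _ → ~refl

  total-swap : ∀ {A B} (S : Summation A) (T : Summation B) (f : A → B → Carrier) →
    total S M (λ a → total T M (f a)) ~ total T M (λ b → total S M λ a → f a b)
  total-swap {A} {B} S T f = ~trans
    (~sym (total-rel S Mᴮ M (λ φ x → total T M φ ~ x) (total-ε T)
      (λ {φ} {_} {χ} φx χy → ~trans (total-∙ T φ χ) (∙-cong φx χy)) λ _ → ~refl))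
    (total-cong T λ b → total-rel S Mᴮ M (λ φ x → φ b ~ x) ~refl ∙-cong λ _ → ~refl)
    where
    Mᴮ : RawMonoid 0ℓ 0ℓ
    Mᴮ = record { Carrier = B → Carrier ; _≈_ = _≡_ ; _∙_ = λ φ χ b → φ b ∙ χ b ; ε = λ _ → ε }

  -- Reindexing reduces to interchange: the matrix `δ` has one nonzero entry in each row and each
  -- column, so its row sums give the left side and its column sums the right.
  total-involution : ∀ {A} (S : Summation A) → DecidableEquality A →
    ∀ (σ : A → A) → (∀ a → σ (σ a) ≡ a) → ∀ f → total S M (f ∘ σ) ~ total S M f
  total-involution {A} S _≟ᴬ_ σ σσ f = begin
    total S M (λ a → f (σ a))
      ≈⟨ total-cong S (λ a → ~trans
           (total-single S M isCM (σ a) (δ a) (λ b b≢ → off a b b≢))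
           (on a (σ a) refl)) ⟨
    total S M (λ a → total S M λ b → δ a b)    ≈⟨ total-swap S S δ ⟩
    total S M (λ b → total S M λ a → δ a b)
      ≈⟨ total-cong S (λ b → ~trans
           (total-single S M isCM (σ b) (λ a → δ a b) (λ a a≢ → off a b λ { refl → a≢ (sym (σσ a)) }))
           (on (σ b) b (sym (σσ b)))) ⟩
    total S M f    ∎
    where
    open import Relation.Binary.Reasoning.Setoid setoid
    δ : A → A → Carrier
    δ a b = if does (b ≟ᴬ σ a) then f b else ε
    off : ∀ a b → b ≢ σ a → δ a b ~ ε
    off a b b≢ with b ≟ᴬ σ a
    ... | yes b≡ = contradiction b≡ b≢
    ... | no  _  = ~refl
    on : ∀ a b → b ≡ σ a → δ a b ~ f b
    on a b b≡ with b ≟ᴬ σ a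
    ... | yes _ = ~refl
    ... | no b≢ = contradiction b≡ b≢

  -- The pairs `(v , v [ i ]≔ c)` run once through all ordered pairs of vectors that agree off
  -- position `i`, and this family is closed under exchanging the two vectors.
  total-update : ∀ {A} (S : Summation A) {k} i (H : Vec A k → Vec A k → Carrier) →
    total (vec S k) M (λ v → total S M λ c → H v (v [ i ]≔ c)) ~
    total (vec S k) M (λ v → total S M λ c → H (v [ i ]≔ c) v)
  total-update S {suc k} zero H = begin
    (∑ λ b → ∑ᵛ λ r → ∑ λ c → H (b ∷ r) (c ∷ r))    ≈⟨ total-swap S (vec S k) _ ⟩
    (∑ᵛ λ r → ∑ λ b → ∑ λ c → H (b ∷ r) (c ∷ r))    ≈⟨ total-cong (vec S k) (λ r → total-swap S S _) ⟩
    (∑ᵛ λ r → ∑ λ c → ∑ λ b → H (b ∷ r) (c ∷ r))    ≈⟨ total-swap S (vec S k) _ ⟨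
    (∑ λ c → ∑ᵛ λ r → ∑ λ b → H (b ∷ r) (c ∷ r))    ∎
    where
    open import Relation.Binary.Reasoning.Setoid setoid
    ∑ = total S M
    ∑ᵛ = total (vec S k) M
  total-update S {suc k} (suc i) H =
    total-cong S λ b → total-update S i λ v w → H (b ∷ v) (b ∷ w)

∑ : ∀ {A} → Summation A → (A → ℝ) → ℝ
∑ S = total S +-0-rawMonoidᴿ

open SumProperties +-0-rawMonoidᴿ _≃_ +-0-isCommutativeMonoid public
  renaming ( total-cong to ∑-cong ; total-ε to ∑-0 ; total-∙ to ∑-+ ; total-swap to ∑-swap
           ; total-involution to ∑-involution ; total-update to ∑-update ; interchange to +-interchange )

∑-single : ∀ {A} (S : Summation A) a f → (∀ b → b ≢ a → f b ≃ 0ℝ) → ∑ S f ≃ f a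
∑-single S = total-single S +-0-rawMonoidᴿ +-0-isCommutativeMonoid

∑-mono : ∀ {A} (S : Summation A) {f g} → (∀ a → f a ≼ g a) → ∑ S f ≼ ∑ S g
∑-mono S = total-rel S +-0-rawMonoidᴿ +-0-rawMonoidᴿ _≼_ ≼-refl +-mono-≼

∑-⋆ : ∀ {A} (S : Summation A) k f → ∑ S (λ a → k ⋆ f a) ≃ k ⋆ ∑ S f
∑-⋆ S k f = total-rel S +-0-rawMonoidᴿ +-0-rawMonoidᴿ (λ x y → x ≃ k ⋆ y) (≃-sym (⋆-zeroʳ k))
  (λ {_} {y} {_} {v} p q → ≃-trans (+-cong p q) (≃-sym (⋆-distribˡ k y v))) λ _ → ≃-refl

∑ℕ : ∀ {A} → Summation A → (A → ℕ) → ℕ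
∑ℕ S = total S ℕ.+-0-rawMonoid

∑-∑ℕ : ∀ {A} (S : Summation A) g x → ∑ S (λ a → g a ⋆ x) ≃ ∑ℕ S g ⋆ x
∑-∑ℕ S g x = total-rel S +-0-rawMonoidᴿ ℕ.+-0-rawMonoid (λ y k → y ≃ k ⋆ x) (≃-sym (⋆-zeroˡ x))
  (λ {_} {k} {_} {l} p q → ≃-trans (+-cong p q) (≃-sym (⋆-distribʳ x k l))) λ _ → ≃-refl

∑ℕ-mono : ∀ {A} (S : Summation A) {f g} → (∀ a → f a ℕ.≤ g a) → ∑ℕ S f ℕ.≤ ∑ℕ S g
∑ℕ-mono S = total-rel S ℕ.+-0-rawMonoid ℕ.+-0-rawMonoid ℕ._≤_ ℕ.z≤n ℕ.+-mono-≤

card : ∀ {A} → Summation A → ℕ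
card S = ∑ℕ S λ _ → 1

∑-const : ∀ {A} (S : Summation A) x → ∑ S (λ _ → x) ≃ card S ⋆ x
∑-const S x = ≃-trans (∑-cong S λ _ → ≃-sym (*-identityˡ x)) (∑-∑ℕ S (λ _ → 1) x)

card-positive : ∀ {A} (S : Summation A) → DecidableEquality A → A → 1 ℕ.≤ card S
card-positive {A} S _≟ᴬ_ a = subst (ℕ._≤ card S) picked (∑ℕ-mono S below)
  where
  δ : A → ℕ
  δ b = if does (b ≟ᴬ a) then 1 else 0
  below : ∀ b → δ b ℕ.≤ 1
  below b with b ≟ᴬ a
  ... | yes _ = ℕ.≤-refl
  ... | no  _ = ℕ.z≤n
  off : ∀ b → b ≢ a → δ b ≡ 0
  off b b≢a with b ≟ᴬ a
  ... | yes b≡a = contradiction b≡a b≢a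
  ... | no  _   = refl
  on : δ a ≡ 1
  on with a ≟ᴬ a
  ... | yes _  = refl
  ... | no a≢a = contradiction refl a≢a
  picked : ∑ℕ S δ ≡ 1
  picked = trans (total-single S ℕ.+-0-rawMonoid ℕ.+-0-isCommutativeMonoid a δ off) on

card-fin : ∀ n → card (fin n) ≡ n
card-fin zero    = refl
card-fin (suc n) = cong suc (card-fin n)

-- Complex numbers and unitary operators

infix 4 _≃ᶜ_

record _≃ᶜ_ (x y : ℂ) : Set where
  constructor _,_
  field
    re-≃ : re x ≃ re y
    im-≃ : im x ≃ im y

open _≃ᶜ_

pointwise-≃ᶜ : ∀ {x y} → (∀ n → seq (re x) n ≡ seq (re y) n) → (∀ n → seq (im x) n ≡ seq (im y) n) → x ≃ᶜ y
pointwise-≃ᶜ re≡ im≡ = pointwise-≃ re≡ , pointwise-≃ im≡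

+ᶜ-0-isCommutativeMonoid : IsCommutativeMonoid _≃ᶜ_ _+ᶜ_ 0ℂ
+ᶜ-0-isCommutativeMonoid = record
  { isMonoid = record
    { isSemigroup = record
      { isMagma = record
        { isEquivalence = record
          { refl  = ≃-refl , ≃-refl
          ; sym   = λ { (p , q) → ≃-sym p , ≃-sym q }
          ; trans = λ { (p , q) (p′ , q′) → ≃-trans p p′ , ≃-trans q q′ }
          }
        ; ∙-cong = λ { (p , q) (p′ , q′) → +-cong p p′ , +-cong q q′ }
        }
      ; assoc = λ x y z → +-assoc (re x) (re y) (re z) , +-assoc (im x) (im y) (im z)
      }
    ; identity = (λ x → +-identityˡ (re x) , +-identityˡ (im x))
               , (λ x → +-identityʳ (re x) , +-identityʳ (im x))
    }
  ; comm = λ x y → +-comm (re x) (re y) , +-comm (im x) (im y)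
  }

open IsCommutativeMonoid +ᶜ-0-isCommutativeMonoid public using ()
  renaming ( refl to ≃ᶜ-refl ; reflexive to ≃ᶜ-reflexive ; sym to ≃ᶜ-sym ; trans to ≃ᶜ-trans ; setoid to ≃ᶜ-setoid
           ; ∙-cong to +ᶜ-cong )

*ᶜ-cong : ∀ {x x′ y y′} → x ≃ᶜ x′ → y ≃ᶜ y′ → x *ᶜ y ≃ᶜ x′ *ᶜ y′
*ᶜ-cong (p , q) (p′ , q′) =
  +-cong (*-cong p p′) (neg-cong (*-cong q q′)) , +-cong (*-cong p q′) (*-cong q p′)

module ℂ-Laws where
  open +-*-Solver

  *ᶜ-zeroˡ : ∀ x → 0ℂ *ᶜ x ≃ᶜ 0ℂ
  *ᶜ-zeroˡ (a +i b) = pointwise-≃ᶜ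
    (λ n → solve 2 (λ a b → con 0ℚ :* a :+ :- (con 0ℚ :* b) := con 0ℚ) refl (seq a n) (seq b n))
    (λ n → solve 2 (λ a b → con 0ℚ :* b :+ con 0ℚ :* a := con 0ℚ) refl (seq a n) (seq b n))

  *ᶜ-zeroʳ : ∀ x → x *ᶜ 0ℂ ≃ᶜ 0ℂ
  *ᶜ-zeroʳ (a +i b) = pointwise-≃ᶜ
    (λ n → solve 2 (λ a b → a :* con 0ℚ :+ :- (b :* con 0ℚ) := con 0ℚ) refl (seq a n) (seq b n))
    (λ n → solve 2 (λ a b → a :* con 0ℚ :+ b :* con 0ℚ := con 0ℚ) refl (seq a n) (seq b n))

  *ᶜ-identityʳ : ∀ x → x *ᶜ 1ℂ ≃ᶜ x
  *ᶜ-identityʳ (a +i b) = pointwise-≃ᶜ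
    (λ n → solve 2 (λ a b → a :* con 1ℚ :+ :- (b :* con 0ℚ) := a) refl (seq a n) (seq b n))
    (λ n → solve 2 (λ a b → a :* con 0ℚ :+ b :* con 1ℚ := b) refl (seq a n) (seq b n))

  *ᶜ-distribˡ : ∀ x y z → x *ᶜ (y +ᶜ z) ≃ᶜ x *ᶜ y +ᶜ x *ᶜ z
  *ᶜ-distribˡ (a +i b) (c +i d) (e +i f) = pointwise-≃ᶜ
    (λ n → solve 6 (λ a b c d e f → a :* (c :+ e) :+ :- (b :* (d :+ f))
      := (a :* c :+ :- (b :* d)) :+ (a :* e :+ :- (b :* f))) refl
      (seq a n) (seq b n) (seq c n) (seq d n) (seq e n) (seq f n))
    (λ n → solve 6 (λ a b c d e f → a :* (d :+ f) :+ b :* (c :+ e)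
      := (a :* d :+ b :* c) :+ (a :* f :+ b :* e)) refl
      (seq a n) (seq b n) (seq c n) (seq d n) (seq e n) (seq f n))

  *ᶜ-distribʳ : ∀ x y z → (y +ᶜ z) *ᶜ x ≃ᶜ y *ᶜ x +ᶜ z *ᶜ x
  *ᶜ-distribʳ (a +i b) (c +i d) (e +i f) = pointwise-≃ᶜ
    (λ n → solve 6 (λ a b c d e f → (c :+ e) :* a :+ :- ((d :+ f) :* b)
      := (c :* a :+ :- (d :* b)) :+ (e :* a :+ :- (f :* b))) refl
      (seq a n) (seq b n) (seq c n) (seq d n) (seq e n) (seq f n))
    (λ n → solve 6 (λ a b c d e f → (c :+ e) :* b :+ (d :+ f) :* a
      := (c :* b :+ d :* a) :+ (e :* b :+ f :* a)) refl
      (seq a n) (seq b n) (seq c n) (seq d n) (seq e n) (seq f n))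

  conj-+ : ∀ x y → conj (x +ᶜ y) ≃ᶜ conj x +ᶜ conj y
  conj-+ (a +i b) (c +i d) = ≃-refl , pointwise-≃
    (λ n → solve 2 (λ b d → :- (b :+ d) := :- b :+ :- d) refl (seq b n) (seq d n))

  -- Separates state entries from operator entries, so that in the norm of `U · ψ` the sum over rows
  -- falls on the operator entries alone.
  conj-*-* : ∀ u x v y → conj (u *ᶜ x) *ᶜ (v *ᶜ y) ≃ᶜ (conj x *ᶜ y) *ᶜ (conj u *ᶜ v)
  conj-*-* (a +i b) (c +i d) (e +i f) (g +i h) = pointwise-≃ᶜ
    (λ n → solve 8 (λ a b c d e f g h →
      (a :* c :+ :- (b :* d)) :* (e :* g :+ :- (f :* h)) :+ :- (:- (a :* d :+ b :* c) :* (e :* h :+ f :* g))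
      := (c :* g :+ :- (:- d :* h)) :* (a :* e :+ :- (:- b :* f)) :+ :- ((c :* h :+ :- d :* g) :* (a :* f :+ :- b :* e)))
      refl (seq a n) (seq b n) (seq c n) (seq d n) (seq e n) (seq f n) (seq g n) (seq h n))
    (λ n → solve 8 (λ a b c d e f g h →
      (a :* c :+ :- (b :* d)) :* (e :* h :+ f :* g) :+ :- (a :* d :+ b :* c) :* (e :* g :+ :- (f :* h))
      := (c :* g :+ :- (:- d :* h)) :* (a :* f :+ :- b :* e) :+ (c :* h :+ :- d :* g) :* (a :* e :+ :- (:- b :* f)))
      refl (seq a n) (seq b n) (seq c n) (seq d n) (seq e n) (seq f n) (seq g n) (seq h n))

  ∣∣²-conj : ∀ x → ∣ x ∣² ≃ re (conj x *ᶜ x)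
  ∣∣²-conj (a +i b) = pointwise-≃
    (λ n → solve 2 (λ a b → a :* a :+ b :* b := a :* a :+ :- (:- b :* b)) refl (seq a n) (seq b n))

open ℂ-Laws

infixl 6 _-ᶜ_

_-ᶜ_ : ℂ → ℂ → ℂ
x -ᶜ y = (re x + - re y) +i (im x + - im y)

∣∣²-cong : ∀ {x y} → x ≃ᶜ y → ∣ x ∣² ≃ ∣ y ∣²
∣∣²-cong (p , q) = +-cong (*-cong p p) (*-cong q q)

∣∣²-nonneg : ∀ x → 0ℝ ≼ ∣ x ∣²
∣∣²-nonneg (a +i b) = pointwise-≼ λ n → ℚ.+-mono-≤ (square-nonneg (seq a n)) (square-nonneg (seq b n))

∣x-x∣²≃0 : ∀ x → ∣ x -ᶜ x ∣² ≃ 0ℝ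
∣x-x∣²≃0 (a +i b) = pointwise-≃ λ n → solve 2
  (λ a b → (a :+ :- a) :* (a :+ :- a) :+ (b :+ :- b) :* (b :+ :- b) := con 0ℚ) refl (seq a n) (seq b n)
  where open +-*-Solver

∑C : ∀ {A} → Summation A → (A → ℂ) → ℂ
∑C S = total S +-0-rawMonoidᶜ

module ∑C = SumProperties +-0-rawMonoidᶜ _≃ᶜ_ +ᶜ-0-isCommutativeMonoid

∑C-*ˡ : ∀ {A} (S : Summation A) z f → z *ᶜ ∑C S f ≃ᶜ ∑C S (λ a → z *ᶜ f a)
∑C-*ˡ S z f = total-rel S +-0-rawMonoidᶜ +-0-rawMonoidᶜ (λ x y → z *ᶜ x ≃ᶜ y) (*ᶜ-zeroʳ z)
  (λ {x} {_} {u} p q → ≃ᶜ-trans (*ᶜ-distribˡ z x u) (+ᶜ-cong p q)) λ _ → ≃ᶜ-refl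

∑C-*ʳ : ∀ {A} (S : Summation A) z f → ∑C S f *ᶜ z ≃ᶜ ∑C S (λ a → f a *ᶜ z)
∑C-*ʳ S z f = total-rel S +-0-rawMonoidᶜ +-0-rawMonoidᶜ (λ x y → x *ᶜ z ≃ᶜ y) (*ᶜ-zeroˡ z)
  (λ {x} {_} {u} p q → ≃ᶜ-trans (*ᶜ-distribʳ z x u) (+ᶜ-cong p q)) λ _ → ≃ᶜ-refl

∑C-conj : ∀ {A} (S : Summation A) f → conj (∑C S f) ≃ᶜ ∑C S (conj ∘ f)
∑C-conj S f = total-rel S +-0-rawMonoidᶜ +-0-rawMonoidᶜ (λ x y → conj x ≃ᶜ y)
  (≃-refl , pointwise-≃ λ _ → refl)
  (λ {x} {_} {u} p q → ≃ᶜ-trans (conj-+ x u) (+ᶜ-cong p q)) λ _ → ≃ᶜ-refl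

re-∑C : ∀ {A} (S : Summation A) f → re (∑C S f) ≃ ∑ S (re ∘ f)
re-∑C S f = total-rel S +-0-rawMonoidᶜ +-0-rawMonoidᴿ (λ x y → re x ≃ y) ≃-refl +-cong λ _ → ≃-refl

module _ {n b w : ℕ} where

  private B = basis n b w

  norm² : State n b w → ℝ
  norm² ψ = ∑ B λ s → ∣ ψ s ∣²

  infix 6 _⊖_

  _⊖_ : State n b w → State n b w → State n b w
  (ψ ⊖ φ) s = ψ s -ᶜ φ s

  dist² : State n b w → State n b w → ℝ
  dist² ψ φ = norm² (ψ ⊖ φ)

  ket-self : ∀ s → ket {n} {b} {w} s s ≡ 1ℂ
  ket-self s with s ≟ s
  ... | yes _  = refl
  ... | no s≢s = contradiction refl s≢s

  ket-other : ∀ s t → t ≢ s → ket {n} {b} {w} s t ≡ 0ℂ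
  ket-other s t t≢s with s ≟ t
  ... | yes s≡t = contradiction (sym s≡t) t≢s
  ... | no  _   = refl

  norm²-ket : ∀ s → norm² (ket s) ≃ 1ℝ
  norm²-ket s = ≃-trans
    (∑-single B s _ λ t t≢s → ≃-trans (≃-reflexive (cong ∣_∣² (ket-other s t t≢s))) (pointwise-≃ λ _ → refl))
    (≃-trans (≃-reflexive (cong ∣_∣² (ket-self s))) (pointwise-≃ λ _ → refl))
  norm²-conj : ∀ ψ → norm² ψ ≃ re (∑C B λ s → conj (ψ s) *ᶜ ψ s)
  norm²-conj ψ = ≃-trans (∑-cong B λ s → ∣∣²-conj (ψ s)) (≃-sym (re-∑C B λ s → conj (ψ s) *ᶜ ψ s))

  -- The squared norm expands into a triple sum; summing over the row index `s` first leaves entries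
  -- of `U † ⊙ U`, which are Kronecker deltas.
  norm²-unitary : ∀ {U} → IsUnitary U → ∀ ψ → norm² (U · ψ) ≃ norm² ψ
  norm²-unitary {U} (U†U≈1 , _) ψ =
    ≃-trans (norm²-conj (U · ψ)) (≃-trans (re-≃ expand) (≃-sym (norm²-conj ψ)))
    where
    open import Relation.Binary.Reasoning.Setoid ≃ᶜ-setoid
    z = λ t t′ → conj (ψ t) *ᶜ ψ t′
    expand : ∑C B (λ s → conj ((U · ψ) s) *ᶜ (U · ψ) s) ≃ᶜ ∑C B (λ t → z t t)
    expand = begin
      ∑C B (λ s → conj (∑C B λ t → U s t *ᶜ ψ t) *ᶜ ∑C B λ t → U s t *ᶜ ψ t)
        ≈⟨ ∑C.total-cong B (λ s → ≃ᶜ-trans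
             (*ᶜ-cong (∑C-conj B _) ≃ᶜ-refl)
             (≃ᶜ-trans (∑C-*ʳ B _ _) (∑C.total-cong B λ t → ∑C-*ˡ B _ _))) ⟩
      ∑C B (λ s → ∑C B λ t → ∑C B λ t′ → conj (U s t *ᶜ ψ t) *ᶜ (U s t′ *ᶜ ψ t′))
        ≈⟨ ∑C.total-swap B B _ ⟩
      ∑C B (λ t → ∑C B λ s → ∑C B λ t′ → conj (U s t *ᶜ ψ t) *ᶜ (U s t′ *ᶜ ψ t′))
        ≈⟨ ∑C.total-cong B (λ t → ∑C.total-swap B B _) ⟩
      ∑C B (λ t → ∑C B λ t′ → ∑C B λ s → conj (U s t *ᶜ ψ t) *ᶜ (U s t′ *ᶜ ψ t′))
        ≈⟨ ∑C.total-cong B (λ t → ∑C.total-cong B λ t′ → ≃ᶜ-trans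
             (∑C.total-cong B λ s → conj-*-* (U s t) (ψ t) (U s t′) (ψ t′))
             (≃ᶜ-sym (∑C-*ˡ B (z t t′) _))) ⟩
      ∑C B (λ t → ∑C B λ t′ → z t t′ *ᶜ (U † ⊙ U) t t′)
        ≈⟨ ∑C.total-cong B (λ t → ∑C.total-cong B λ t′ →
             *ᶜ-cong (≃ᶜ-refl {z t t′}) (wrap (proj₁ (U†U≈1 t t′)) , wrap (proj₂ (U†U≈1 t t′)))) ⟩
      ∑C B (λ t → ∑C B λ t′ → z t t′ *ᶜ ket t t′)
        ≈⟨ ∑C.total-cong B (λ t → ≃ᶜ-trans
             (total-single B +-0-rawMonoidᶜ +ᶜ-0-isCommutativeMonoid t _ λ t′ t′≢t → ≃ᶜ-trans
               (*ᶜ-cong (≃ᶜ-refl {z t t′}) (≃ᶜ-reflexive (ket-other t t′ t′≢t))) (*ᶜ-zeroʳ (z t t′)))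
             (≃ᶜ-trans (*ᶜ-cong (≃ᶜ-refl {z t t}) (≃ᶜ-reflexive (ket-self t))) (*ᶜ-identityʳ (z t t)))) ⟩
      ∑C B (λ t → z t t)    ∎

  -- The summation lemmas know only monoids, so linearity is proved as `U · (ψ ⊖ φ)` plus `U · φ`
  -- being `U · ψ`, and one term is moved across.
  ·-⊖ : ∀ U ψ φ s → (U · ψ ⊖ U · φ) s ≃ᶜ (U · (ψ ⊖ φ)) s
  ·-⊖ U ψ φ s = ≃ᶜ-sym (move _ _ _ (≃ᶜ-trans (≃ᶜ-sym (∑C.total-∙ B _ _))
    (∑C.total-cong B λ t → split (U s t) (ψ t) (φ t))))
    where
    open +-*-Solver
    sub-+ : ∀ a b → (a + - b) + b ≃ a
    sub-+ a b = pointwise-≃ λ n → solve 2 (λ a b → (a :+ :- b) :+ b := a) refl (seq a n) (seq b n)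
    +-sub : ∀ a b → (a + b) + - b ≃ a
    +-sub a b = pointwise-≃ λ n → solve 2 (λ a b → (a :+ b) :+ :- b := a) refl (seq a n) (seq b n)
    split : ∀ u x y → u *ᶜ (x -ᶜ y) +ᶜ u *ᶜ y ≃ᶜ u *ᶜ x
    split u x y = ≃ᶜ-trans (≃ᶜ-sym (*ᶜ-distribˡ u (x -ᶜ y) y))
      (*ᶜ-cong (≃ᶜ-refl {u}) (sub-+ (re x) (re y) , sub-+ (im x) (im y)))
    move : ∀ x y z → x +ᶜ y ≃ᶜ z → x ≃ᶜ z -ᶜ y
    move x y z (p , q) =
        ≃-trans (≃-sym (+-sub (re x) (re y))) (+-cong p ≃-refl)
      , ≃-trans (≃-sym (+-sub (im x) (im y))) (+-cong q ≃-refl)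

  dist²-unitary : ∀ {U} → IsUnitary U → ∀ ψ φ → dist² (U · ψ) (U · φ) ≃ dist² ψ φ
  dist²-unitary {U} unitary ψ φ =
    ≃-trans (∑-cong B λ s → ∣∣²-cong (·-⊖ U ψ φ s)) (norm²-unitary unitary (ψ ⊖ φ))

  dist²-self : ∀ ψ → dist² ψ ψ ≃ 0ℝ
  dist²-self ψ = ≃-trans (∑-cong B λ s → ∣x-x∣²≃0 (ψ s)) (∑-0 B)

-- One query

-- Completing the square: `w` times the form is `(w a + s c)² + r c²`, where `r` is the slack in the
-- discriminant condition.
quadratic-form-nonneg : ∀ {s w w′ r} a c → 0ℚ ℚ.< w → 0ℚ ℚ.≤ r → w ℚ.* w′ ≡ s ℚ.* s ℚ.+ r →
  0ℚ ℚ.≤ w ℚ.* (a ℚ.* a) ℚ.+ (s ℚ.* (a ℚ.* c) ℚ.+ s ℚ.* (a ℚ.* c)) ℚ.+ w′ ℚ.* (c ℚ.* c)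
quadratic-form-nonneg {s} {w} {w′} {r} a c 0<w 0≤r ww′≡ =
  ℚ.*-cancelˡ-≤-pos w {{ℚ.positive 0<w}} (subst₂ ℚ._≤_ (sym (ℚ.*-zeroʳ w)) (sym complete-square)
    (ℚ.+-mono-≤ (square-nonneg (w ℚ.* a ℚ.+ s ℚ.* c))
      (subst (ℚ._≤ r ℚ.* (c ℚ.* c)) (ℚ.*-zeroˡ (c ℚ.* c))
        (ℚ.*-monoʳ-≤-nonNeg (c ℚ.* c) {{ℚ.nonNegative (square-nonneg c)}} 0≤r))))
  where
  open +-*-Solver
  form = w ℚ.* (a ℚ.* a) ℚ.+ (s ℚ.* (a ℚ.* c) ℚ.+ s ℚ.* (a ℚ.* c)) ℚ.+ w′ ℚ.* (c ℚ.* c)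
  square = (w ℚ.* a ℚ.+ s ℚ.* c) ℚ.* (w ℚ.* a ℚ.+ s ℚ.* c)
  complete-square : w ℚ.* form ≡ square ℚ.+ r ℚ.* (c ℚ.* c)
  complete-square = trans
    (solve 5 (λ s w w′ a c →
      w :* (w :* (a :* a) :+ (s :* (a :* c) :+ s :* (a :* c)) :+ w′ :* (c :* c))
      := (w :* a :+ s :* c) :* (w :* a :+ s :* c) :+ (w :* w′ :- s :* s) :* (c :* c)) refl s w w′ a c)
    (cong (λ x → square ℚ.+ x ℚ.* (c ℚ.* c))
      (trans (cong (ℚ._- s ℚ.* s) ww′≡)
        (solve 2 (λ s r → (s :* s :+ r) :- s :* s := r) refl s r)))

≤-by-difference : ∀ {p q d} → 0ℚ ℚ.≤ d → p ℚ.+ d ≡ q → p ℚ.≤ q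
≤-by-difference {p} 0≤d p+d≡q = subst₂ ℚ._≤_ (ℚ.+-identityʳ p) p+d≡q (ℚ.+-monoʳ-≤ p 0≤d)

-- The cross term `2 s a c` is at most `ω a² + ω′ c²` in absolute value once `s² ≤ ω ω′`. It is
-- applied to real and imaginary parts separately, and in both signs: `s` times the squared distance
-- and `s` times the sum of the squared moduli differ only by such cross terms.
module WeightedAMGM (s ω ω′ : ℕ) (0<ω : 1 ℕ.≤ ω) (s²≤ωω′ : s ℕ.* s ℕ.≤ ω ℕ.* ω′) where

  private
    S W W′ R : ℚ
    S  = + s / 1
    W  = + ω / 1
    W′ = + ω′ / 1
    R  = + (ω ℕ.* ω′ ℕ.∸ s ℕ.* s) / 1

    form-nonneg : ∀ a c → 0ℚ ℚ.≤ W ℚ.* (a ℚ.* a) ℚ.+ (S ℚ.* (a ℚ.* c) ℚ.+ S ℚ.* (a ℚ.* c)) ℚ.+ W′ ℚ.* (c ℚ.* c)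
    form-nonneg a c = quadratic-form-nonneg {S} {W} {W′} {R} a c
      (ℚ.<-≤-trans (ℚ.positive⁻¹ 1ℚ) (/1-mono-≤ 0<ω))
      (/1-mono-≤ {0} {ω ℕ.* ω′ ℕ.∸ s ℕ.* s} ℕ.z≤n)
      (trans (sym (/1-homo-* ω ω′)) (trans (cong (λ x → + x / 1) (sym (ℕ.m+[n∸m]≡n s²≤ωω′)))
        (trans (/1-homo-+ (s ℕ.* s) _) (cong (ℚ._+ R) (/1-homo-* s s)))))

  open +-*-Solver

  ∣-∣²-upper : ∀ x y → s ⋆ ∣ x -ᶜ y ∣² ≼ s ⋆ (∣ x ∣² + ∣ y ∣²) + (ω ⋆ ∣ x ∣² + ω′ ⋆ ∣ y ∣²)
  ∣-∣²-upper (a +i b) (c +i d) = pointwise-≼ λ n → ≤-by-difference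
    (ℚ.+-mono-≤ (form-nonneg (seq a n) (seq c n)) (form-nonneg (seq b n) (seq d n)))
    (solve 7 (λ s w w′ a b c d →
      s :* ((a :+ :- c) :* (a :+ :- c) :+ (b :+ :- d) :* (b :+ :- d))
        :+ ((w :* (a :* a) :+ (s :* (a :* c) :+ s :* (a :* c)) :+ w′ :* (c :* c))
          :+ (w :* (b :* b) :+ (s :* (b :* d) :+ s :* (b :* d)) :+ w′ :* (d :* d)))
      := s :* ((a :* a :+ b :* b) :+ (c :* c :+ d :* d))
        :+ (w :* (a :* a :+ b :* b) :+ w′ :* (c :* c :+ d :* d)))
      refl S W W′ (seq a n) (seq b n) (seq c n) (seq d n))

  ∣-∣²-lower : ∀ x y → s ⋆ (∣ x ∣² + ∣ y ∣²) ≼ s ⋆ ∣ x -ᶜ y ∣² + (ω ⋆ ∣ x ∣² + ω′ ⋆ ∣ y ∣²)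
  ∣-∣²-lower (a +i b) (c +i d) = pointwise-≼ λ n → ≤-by-difference
    (ℚ.+-mono-≤ (form-nonneg (seq a n) (ℚ.- seq c n)) (form-nonneg (seq b n) (ℚ.- seq d n)))
    (solve 7 (λ s w w′ a b c d →
      s :* ((a :* a :+ b :* b) :+ (c :* c :+ d :* d))
        :+ ((w :* (a :* a) :+ (s :* (a :* :- c) :+ s :* (a :* :- c)) :+ w′ :* (:- c :* :- c))
          :+ (w :* (b :* b) :+ (s :* (b :* :- d) :+ s :* (b :* :- d)) :+ w′ :* (:- d :* :- d)))
      := s :* ((a :+ :- c) :* (a :+ :- c) :+ (b :+ :- d) :* (b :+ :- d))
        :+ (w :* (a :* a :+ b :* b) :+ w′ :* (c :* c :+ d :* d)))
      refl S W W′ (seq a n) (seq b n) (seq c n) (seq d n))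

zipWith-xor-involutive : ∀ {b} (z x : Vec Bool b) → zipWith _xor_ (zipWith _xor_ z x) x ≡ z
zipWith-xor-involutive []      []      = refl
zipWith-xor-involutive (z ∷ zs) (x ∷ xs) = cong₂ _∷_
  (trans (Bool.xor-assoc z x x) (trans (cong (z xor_) (Bool.xor-same x)) (Bool.xor-identityʳ z)))
  (zipWith-xor-involutive zs xs)

-- The branches of `d` become separate summands, so that each can be reindexed by its own
-- permutation of the basis.
≼-if-split : ∀ d {l same left right} → (d ≡ false → l ≼ same) → (d ≡ true → l ≼ left + right) →
  l ≼ (if d then 0ℝ else same) + (if d then left else 0ℝ) + (if d then right else 0ℝ)
≼-if-split false {same = same} h _ = ≼-trans (h refl)
  (≃⇒≼ (≃-sym (≃-trans (+-identityʳ (same + 0ℝ)) (+-identityʳ same))))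
≼-if-split true {left = left} _ h = ≼-trans (h refl) (≃⇒≼ (+-cong (≃-sym (+-identityˡ left)) ≃-refl))

if-split-≼ : ∀ d {same left right r} → (d ≡ false → same ≼ r) → (d ≡ true → left + right ≼ r) →
  (if d then 0ℝ else same) + (if d then left else 0ℝ) + (if d then right else 0ℝ) ≼ r
if-split-≼ false {same} h _ = ≼-trans (≃⇒≼ (≃-trans (+-identityʳ (same + 0ℝ)) (+-identityʳ same))) (h refl)
if-split-≼ true {left = left} _ h = ≼-trans (≃⇒≼ (+-cong (+-identityˡ left) ≃-refl)) (h refl)

Answers : ℕ → ℕ → Set
Answers n b = Fin n → Fin n → Vec Bool b

restrict : ∀ {n} → (Fin n → Fin n → Bool) → (Fin n → Fin n → ℕ) → Fin n → Fin n → ℕ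
restrict D ω i j = if D i j then ω i j else 0

module _ {n b w : ℕ} where

  private B = basis n b w

  query : {C : Set} → (Fin n → Fin n → C) → Basis n b w → C
  query g (i , j , _) = g i j

  answer : Answers n b → Basis n b w → Basis n b w
  answer X (i , j , z , a) = i , j , zipWith _xor_ z (X i j) , a

  ∑-answer : ∀ X f → ∑ B (f ∘ answer X) ≃ ∑ B f
  ∑-answer X f = ∑-involution B _≟_ (answer X)
    (λ { (i , j , z , a) → cong (λ z → i , j , z , a) (zipWith-xor-involutive z (X i j)) }) f

  norm²-oracle : ∀ X (ψ : State n b w) → norm² (oracle X ψ) ≃ norm² ψ
  norm²-oracle X ψ = ∑-answer X λ t → ∣ ψ t ∣²

  weight : (Fin n → Fin n → ℕ) → State n b w → ℝ
  weight ω ψ = ∑ B λ t → query ω t ⋆ ∣ ψ t ∣²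

  -- Where `D` is false both oracles permute the basis alike and preserve the distance. Where `D` is
  -- true they permute differently, but each preserves the moduli of its own state, so only the
  -- cross terms can change. AM-GM is used twice, to drop the cross terms after the query and to
  -- restore those before it; hence the factor 2.
  dist²-oracle : ∀ (X X′ : Answers n b) D s ω ω′ →
    (∀ i j → D i j ≡ false → X i j ≡ X′ i j) →
    (∀ i j → D i j ≡ true → 1 ℕ.≤ ω i j × s ℕ.* s ℕ.≤ ω i j ℕ.* ω′ i j) →
    ∀ (ψ ψ′ : State n b w) →
    s ⋆ dist² (oracle X ψ) (oracle X′ ψ′) ≼
    s ⋆ dist² ψ ψ′ + 2 ⋆ (weight (restrict D ω) ψ + weight (restrict D ω′) ψ′)
  dist²-oracle X X′ D s ω ω′ agree amgm ψ ψ′ = begin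
    s ⋆ dist² (oracle X ψ) (oracle X′ ψ′)
      ≈⟨ ∑-⋆ B s _ ⟨
    ∑ B (λ t → s ⋆ ∣ ψ (answer X t) -ᶜ ψ′ (answer X′ t) ∣²)
      ≲⟨ ∑-mono B before ⟩
    ∑ B (λ t → (same (answer X t) + left (answer X t)) + right (answer X′ t))
      -- The two oracles are undone independently; both fix the query registers, hence the value of
      -- `D`.
      ≈⟨ ≃-trans (∑-+ B _ _) (+-cong (∑-answer X _) (∑-answer X′ _)) ⟩
    ∑ B (λ t → same t + left t) + ∑ B right
      ≈⟨ ∑-+ B _ _ ⟨
    ∑ B (λ t → (same t + left t) + right t)
      ≲⟨ ∑-mono B after ⟩
    ∑ B (λ t → s ⋆ ∣ ψ t -ᶜ ψ′ t ∣² + 2 ⋆ (ωψ t + ω′ψ′ t))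
      ≈⟨ ≃-trans (∑-+ B _ _) (+-cong (∑-⋆ B s _)
           (≃-trans (∑-⋆ B 2 _) (⋆-cong 2 (∑-+ B _ _)))) ⟩
    s ⋆ dist² ψ ψ′ + 2 ⋆ (weight (restrict D ω) ψ + weight (restrict D ω′) ψ′)    ∎
    where
    open ≼-Reasoning
    ωψ ω′ψ′ same left right : Basis n b w → ℝ
    ωψ t = query (restrict D ω) t ⋆ ∣ ψ t ∣²
    ω′ψ′ t = query (restrict D ω′) t ⋆ ∣ ψ′ t ∣²
    same t = if query D t then 0ℝ else s ⋆ ∣ ψ t -ᶜ ψ′ t ∣²
    left t = if query D t then s ⋆ ∣ ψ t ∣² + query ω t ⋆ ∣ ψ t ∣² else 0ℝ
    right t = if query D t then s ⋆ ∣ ψ′ t ∣² + query ω′ t ⋆ ∣ ψ′ t ∣² else 0ℝ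

    regroup : ∀ u v p q → s ⋆ (u + v) + (p + q) ≃ (s ⋆ u + p) + (s ⋆ v + q)
    regroup u v p q = ≃-trans (+-cong (⋆-distribˡ s u v) ≃-refl) (+-interchange (s ⋆ u) (s ⋆ v) p q)

    before : ∀ t → s ⋆ ∣ ψ (answer X t) -ᶜ ψ′ (answer X′ t) ∣² ≼
                   (same (answer X t) + left (answer X t)) + right (answer X′ t)
    before t@(i , j , z , a) = ≼-if-split (D i j)
      (λ off → subst (λ x → s ⋆ ∣ ψ (answer X t) -ᶜ ψ′ (i , j , zipWith _xor_ z x , a) ∣² ≼
                            s ⋆ ∣ ψ (answer X t) -ᶜ ψ′ (answer X t) ∣²) (agree i j off) ≼-refl)
      (λ on → ≼-trans
        (WeightedAMGM.∣-∣²-upper s (ω i j) (ω′ i j) (proj₁ (amgm i j on)) (proj₂ (amgm i j on))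
          (ψ (answer X t)) (ψ′ (answer X′ t)))
        (≃⇒≼ (regroup ∣ ψ (answer X t) ∣² ∣ ψ′ (answer X′ t) ∣² _ _)))

    restricted : ∀ i j ω → D i j ≡ true → ω i j ≡ restrict D ω i j
    restricted i j ω on = sym (cong (λ d → if d then ω i j else 0) on)

    after : ∀ t → (same t + left t) + right t ≼ s ⋆ ∣ ψ t -ᶜ ψ′ t ∣² + 2 ⋆ (ωψ t + ω′ψ′ t)
    after t@(i , j , z , a) = if-split-≼ (D i j)
      (λ _ → ≼-trans (≃⇒≼ (≃-sym (+-identityʳ _)))
        (+-mono-≼ ≼-refl (⋆-nonneg 2 (≼-trans (≃⇒≼ (≃-sym (+-identityʳ 0ℝ))) (+-mono-≼
          (⋆-nonneg (restrict D ω i j) (∣∣²-nonneg (ψ t)))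
          (⋆-nonneg (restrict D ω′ i j) (∣∣²-nonneg (ψ′ t))))))))
      (λ on → begin
        (s ⋆ x + ω i j ⋆ x) + (s ⋆ y + ω′ i j ⋆ y)    ≈⟨ regroup x y (ω i j ⋆ x) (ω′ i j ⋆ y) ⟨
        s ⋆ (x + y) + (ω i j ⋆ x + ω′ i j ⋆ y)
          ≲⟨ +-mono-≼ (WeightedAMGM.∣-∣²-lower s (ω i j) (ω′ i j) (proj₁ (amgm i j on))
               (proj₂ (amgm i j on)) (ψ t) (ψ′ t)) ≼-refl ⟩
        (d + (ω i j ⋆ x + ω′ i j ⋆ y)) + (ω i j ⋆ x + ω′ i j ⋆ y)
          ≡⟨ cong₂ (λ k l → d + (k ⋆ x + l ⋆ y) + (k ⋆ x + l ⋆ y))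
               (restricted i j ω on) (restricted i j ω′ on) ⟩
        (d + p) + p        ≈⟨ +-assoc d p p ⟩
        d + (p + p)        ≈⟨ +-cong (≃-refl {d}) (≃-trans (⋆-suc 1 p) (+-cong (≃-refl {p}) (*-identityˡ p))) ⟨
        d + 2 ⋆ p          ∎)
      where
      x = ∣ ψ t ∣²
      y = ∣ ψ′ t ∣²
      d = s ⋆ ∣ ψ t -ᶜ ψ′ t ∣²
      p = ωψ t + ω′ψ′ t

-- Labellings

does-≢ : ∀ {m} {x y : Fin m} → x ≢ y → does (x Fin.≟ y) ≡ false
does-≢ {_} {x} {y} x≢y with x Fin.≟ y
... | yes x≡y = contradiction x≡y x≢y
... | no  _   = refl

does-≡ : ∀ {m} {x y : Fin m} → x ≡ y → does (x Fin.≟ y) ≡ true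
does-≡ {_} {x} {y} x≡y with x Fin.≟ y
... | yes _   = refl
... | no  x≢y = contradiction x≡y x≢y

-- Bound on the weight charged to one move of a point `i` relative to a fixed point `j`. If they are
-- together (`t`), any new centre may part them, at weight 1. If apart, only the centre of `j` joins
-- them (`e`), at weight `m`. Over all centres either case sums to at most `m`, which is what
-- balances the weights.
weighted : ℕ → Bool → Bool → ℕ
weighted m t e = if t then 1 else if e then m else 0

changed-weight-≤ : ∀ m t t′ → (if t xor t′ then (if t then 1 else m) else 0) ℕ.≤ weighted m t t′
changed-weight-≤ m true  true  = ℕ.z≤n
changed-weight-≤ m true  false = ℕ.≤-refl
changed-weight-≤ m false true  = ℕ.≤-refl
changed-weight-≤ m false false = ℕ.z≤n

∑-weighted-≤ : ∀ m t (e : Fin m → Bool) l → (∀ c → c ≢ l → e c ≡ false) →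
  ∑ℕ (fin m) (λ c → weighted m t (e c)) ℕ.≤ m
∑-weighted-≤ m true  e l off = ℕ.≤-reflexive (card-fin m)
∑-weighted-≤ m false e l off = ℕ.≤-trans
  (ℕ.≤-reflexive (total-single (fin m) ℕ.+-0-rawMonoid ℕ.+-0-isCommutativeMonoid l _
    λ c c≢l → cong (λ b → if b then m else 0) (off c c≢l)))
  (at-most (e l))
  where
  at-most : ∀ b → (if b then m else 0) ℕ.≤ m
  at-most true  = ℕ.≤-refl
  at-most false = ℕ.z≤n

module ∑ℕ = SumProperties ℕ.+-0-rawMonoid _≡_ ℕ.+-0-isCommutativeMonoid

-- Of the n points, k are leaves and m are centres; a labelling assigns a
-- centre to every leaf.
module Labelling {n k m : ℕ} (split : Fin n → Fin k ⊎ Fin m) where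

  Labels : Set
  Labels = Vec (Fin m) k

  label : Labels → Fin n → Fin m
  label f i = [ lookup f , id ]′ (split i)

  together : Labels → Fin n → Fin n → Bool
  together f i j = does (label f i Fin.≟ label f j)

  separates : Labels → Labels → Fin n → Fin n → Bool
  separates f g i j = together f i j xor together g i j

  ω : Labels → Fin n → Fin n → ℕ
  ω f i j = if together f i j then 1 else m

  -- Exactly one of the two labellings puts `i` and `j` together, so the product of the weights is
  -- `m`.
  ω-balanced : ∀ {s} → 1 ℕ.≤ m → s ℕ.* s ℕ.≤ m → ∀ f g i j → separates f g i j ≡ true →
    1 ℕ.≤ ω f i j × s ℕ.* s ℕ.≤ ω f i j ℕ.* ω g i j
  ω-balanced {s} 1≤m s²≤m f g i j = balanced (together f i j) (together g i j)
    where
    balanced : ∀ t t′ → t xor t′ ≡ true → let v = if t then 1 else m ; v′ = if t′ then 1 else m in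
      1 ℕ.≤ v × s ℕ.* s ℕ.≤ v ℕ.* v′
    balanced true  false _ = ℕ.≤-refl , subst (s ℕ.* s ℕ.≤_) (sym (ℕ.*-identityˡ m)) s²≤m
    balanced false true  _ = 1≤m , subst (s ℕ.* s ℕ.≤_) (sym (ℕ.*-identityʳ m)) s²≤m

  touches : Fin k → Fin n → Bool
  touches a i = [ (λ a′ → does (a′ Fin.≟ a)) , (λ _ → false) ]′ (split i)

  label-touched : ∀ f a c i → touches a i ≡ true → label (f [ a ]≔ c) i ≡ c
  label-touched f a c i touched with split i
  ... | inj₁ a′ with a′ Fin.≟ a
  ... | yes refl = Vec.lookup∘updateAt a′ f

  label-untouched : ∀ f a c i → touches a i ≡ false → label (f [ a ]≔ c) i ≡ label f i
  label-untouched f a c i untouched with split i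
  ... | inj₂ _ = refl
  ... | inj₁ a′ with a′ Fin.≟ a
  ... | no a′≢a = Vec.lookup∘updateAt′ a′ a a′≢a f

  touched-together : ∀ f a i j → touches a i ≡ true → touches a j ≡ true → label f i ≡ label f j
  touched-together f a i j ti tj with split i | split j
  ... | inj₁ a′ | inj₁ a″ with a′ Fin.≟ a | a″ Fin.≟ a
  ... | yes refl | yes refl = refl

  -- A point is at most one leaf, so at most one `a` contributes; a centre is never moved.
  ∑-touched-≤ : ∀ i h → ∑ℕ (fin m) h ℕ.≤ m →
    ∑ℕ (fin k ⊗ fin m) (λ (a , c) → if touches a i then h c else 0) ℕ.≤ m
  ∑-touched-≤ i h ∑h≤m with split i
  ... | inj₂ _ = subst (ℕ._≤ m) (sym (∑ℕ.total-ε (fin k ⊗ fin m))) ℕ.z≤n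
  ... | inj₁ a′ = ℕ.≤-trans (ℕ.≤-reflexive (trans
    (total-single (fin k) ℕ.+-0-rawMonoid ℕ.+-0-isCommutativeMonoid a′ _ λ a a≢a′ →
      trans (∑ℕ.total-cong (fin m) λ c → cong (λ b → if b then h c else 0) (does-≢ (a≢a′ ∘ sym)))
        (∑ℕ.total-ε (fin m)))
    (∑ℕ.total-cong (fin m) λ c → cong (λ b → if b then h c else 0) (does-≡ {x = a′} refl)))) ∑h≤m

  -- A relabelling of one leaf that changes whether i and j are together must
  -- move i or j; if they were apart, it must move it to the centre of the other.
  count-≤ : ∀ f i j →
    ∑ℕ (fin k ⊗ fin m) (λ (a , c) → restrict (separates f (f [ a ]≔ c)) (ω f) i j) ℕ.≤ 2 ℕ.* m
  count-≤ f i j = ℕ.≤-trans (∑ℕ-mono (fin k ⊗ fin m) λ (a , c) → bound a c _ _ refl refl)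
    (ℕ.≤-trans (ℕ.≤-reflexive (∑ℕ.total-∙ (fin k ⊗ fin m) _ _))
      (ℕ.+-mono-≤ (∑-touched-≤ i _ (∑-weighted-≤ m t _ (label f j) λ _ → does-≢))
        (ℕ.≤-trans (∑-touched-≤ j _ (∑-weighted-≤ m t _ (label f i) λ _ → does-≢ ∘ (_∘ sym)))
          (ℕ.m≤m+n m 0))))
    where
    t = together f i j

    changed : Bool → ℕ
    changed t′ = if t xor t′ then (if t then 1 else m) else 0

    toward-j toward-i : Fin m → ℕ
    toward-j c = weighted m t (does (c Fin.≟ label f j))
    toward-i c = weighted m t (does (label f i Fin.≟ c))

    changed-true : ∀ t t′ e → t ≡ true → (if t xor t′ then (if t then 1 else m) else 0) ℕ.≤ weighted m t e
    changed-true true true  _ _ = ℕ.z≤n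
    changed-true true false _ _ = ℕ.≤-refl

    bound : ∀ a c bi bj → touches a i ≡ bi → touches a j ≡ bj →
      changed (together (f [ a ]≔ c) i j) ℕ.≤
      (if touches a i then toward-j c else 0) ℕ.+ (if touches a j then toward-i c else 0)
    bound a c bi bj ti tj = subst₂
      (λ x y → changed (together (f [ a ]≔ c) i j) ℕ.≤ (if x then toward-j c else 0) ℕ.+ (if y then toward-i c else 0))
      (sym ti) (sym tj) (cases bi bj ti tj)
      where
      cases : ∀ bi bj → touches a i ≡ bi → touches a j ≡ bj →
        changed (together (f [ a ]≔ c) i j) ℕ.≤ (if bi then toward-j c else 0) ℕ.+ (if bj then toward-i c else 0)
      cases false false ti tj
        rewrite label-untouched f a c i ti | label-untouched f a c j tj | Bool.xor-same t = ℕ.z≤n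
      cases true false ti tj
        rewrite label-touched f a c i ti | label-untouched f a c j tj =
        ℕ.≤-trans (changed-weight-≤ m t _) (ℕ.m≤m+n _ 0)
      cases false true ti tj
        rewrite label-untouched f a c i ti | label-touched f a c j tj = changed-weight-≤ m t _
      cases true true ti tj =
        ℕ.≤-trans (changed-true t _ _ (does-≡ (touched-together f a i j ti tj))) (ℕ.m≤m+n (toward-j c) _)

-- The potential

module Potential {n k m b w s : ℕ} (split : Fin n → Fin k ⊎ Fin m)
  (X : Vec (Fin m) k → Answers n b)
  (agree : ∀ f g i j → Labelling.separates split f g i j ≡ false → X f i j ≡ X g i j)
  (1≤m : 1 ℕ.≤ m) (s²≤m : s ℕ.* s ℕ.≤ m) where

  open Labelling split

  F = vec (fin m) k
  P = fin k ⊗ fin m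

  States : Set
  States = Labels → State n b w

  Φ : States → ℝ
  Φ ψ = ∑ F λ f → ∑ P λ (a , c) → dist² (ψ f) (ψ (f [ a ]≔ c))

  -- Upper bound for the increase of `s ⋆ Φ` in one query. The first 2 comes from the two uses of
  -- AM-GM, the second from the two states of each pair; each labelling contributes the count `2 m`
  -- times the norm 1.
  growth : ℝ
  growth = 2 ⋆ 2 ⋆ card F ⋆ (2 ℕ.* m) ⋆ 1ℝ

  ∑FP-cong : ∀ {h h′ : Labels → Fin k × Fin m → ℝ} → (∀ f p → h f p ≃ h′ f p) →
    ∑ F (λ f → ∑ P (h f)) ≃ ∑ F (λ f → ∑ P (h′ f))
  ∑FP-cong h≃h′ = ∑-cong F λ f → ∑-cong P (h≃h′ f)

  ∑FP-+ : ∀ (h h′ : Labels → Fin k × Fin m → ℝ) →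
    ∑ F (λ f → ∑ P λ p → h f p + h′ f p) ≃ ∑ F (λ f → ∑ P (h f)) + ∑ F (λ f → ∑ P (h′ f))
  ∑FP-+ h h′ = ≃-trans (∑-cong F λ f → ∑-+ P (h f) (h′ f)) (∑-+ F _ _)

  ∑FP-⋆ : ∀ r (h : Labels → Fin k × Fin m → ℝ) →
    ∑ F (λ f → ∑ P λ p → r ⋆ h f p) ≃ r ⋆ ∑ F (λ f → ∑ P (h f))
  ∑FP-⋆ r h = ≃-trans (∑-cong F λ f → ∑-⋆ P r (h f)) (∑-⋆ F r _)

  ∑FP-update : ∀ (H : Labels → Labels → ℝ) →
    ∑ F (λ f → ∑ P λ (a , c) → H f (f [ a ]≔ c)) ≃ ∑ F (λ f → ∑ P λ (a , c) → H (f [ a ]≔ c) f)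
  ∑FP-update H = ≃-trans (∑-swap F (fin k) λ f a → ∑ (fin m) λ c → H f (f [ a ]≔ c))
    (≃-trans (∑-cong (fin k) λ a → ∑-update (fin m) a H)
      (≃-sym (∑-swap F (fin k) λ f a → ∑ (fin m) λ c → H (f [ a ]≔ c) f)))

  -- The charge that the AM-GM step puts on the state of `f` when it is compared with `g`.
  flow : States → Labels → Labels → ℝ
  flow ψ f g = weight (restrict (separates f g) (ω f)) (ψ f)

  flow-flip : ∀ ψ f g → weight (restrict (separates f g) (ω g)) (ψ g) ≃ flow ψ g f
  flow-flip ψ f g = ∑-cong (basis n b w) λ { t@(i , j , _) → subst
    (λ d → (if separates f g i j then ω g i j else 0) ⋆ ∣ ψ g t ∣² ≃ (if d then ω g i j else 0) ⋆ ∣ ψ g t ∣²)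
    (Bool.xor-comm (together f i j) (together g i j)) ≃-refl }

  -- At a fixed basis state the squared amplitude of `ψ f` does not depend on the relabelling, so
  -- summing over relabellings first leaves the integer bounded by `count-≤`, times a squared norm.
  flow-≤ : ∀ ψ → (∀ f → norm² (ψ f) ≃ 1ℝ) →
    ∑ F (λ f → ∑ P λ (a , c) → flow ψ f (f [ a ]≔ c)) ≼ card F ⋆ (2 ℕ.* m) ⋆ 1ℝ
  flow-≤ ψ unit = ≼-trans (∑-mono F flow-≤₁) (≃⇒≼ (∑-const F ((2 ℕ.* m) ⋆ 1ℝ)))
    where
    open ≼-Reasoning
    B = basis n b w
    count : Labels → Basis n b w → Fin k × Fin m → ℕ
    count f (i , j , _) (a , c) = restrict (separates f (f [ a ]≔ c)) (ω f) i j
    flow-≤₁ : ∀ f → ∑ P (λ (a , c) → flow ψ f (f [ a ]≔ c)) ≼ (2 ℕ.* m) ⋆ 1ℝ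
    flow-≤₁ f = begin
      ∑ P (λ p → ∑ B λ t → count f t p ⋆ ∣ ψ f t ∣²)    ≈⟨ ∑-swap P B _ ⟩
      ∑ B (λ t → ∑ P λ p → count f t p ⋆ ∣ ψ f t ∣²)    ≈⟨ ∑-cong B (λ t → ∑-∑ℕ P (count f t) ∣ ψ f t ∣²) ⟩
      ∑ B (λ t → ∑ℕ P (count f t) ⋆ ∣ ψ f t ∣²)
        ≲⟨ ∑-mono B (λ t → ⋆-monoˡ-≼ (∣∣²-nonneg (ψ f t)) (count-≤ f (proj₁ t) (proj₁ (proj₂ t)))) ⟩
      ∑ B (λ t → (2 ℕ.* m) ⋆ ∣ ψ f t ∣²)                ≈⟨ ∑-⋆ B (2 ℕ.* m) _ ⟩
      (2 ℕ.* m) ⋆ norm² (ψ f)                           ≈⟨ ⋆-cong (2 ℕ.* m) (unit f) ⟩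
      (2 ℕ.* m) ⋆ 1ℝ                                    ∎

  Φ-oracle : ∀ ψ → (∀ f → norm² (ψ f) ≃ 1ℝ) → s ⋆ Φ (λ f → oracle (X f) (ψ f)) ≼ s ⋆ Φ ψ + growth
  Φ-oracle ψ unit = begin
    s ⋆ Φ (λ f → oracle (X f) (ψ f))    ≈⟨ ∑FP-⋆ s _ ⟨
    ∑ F (λ f → ∑ P λ (a , c) → s ⋆ dist² (oracle (X f) (ψ f)) (oracle (X (f [ a ]≔ c)) (ψ (f [ a ]≔ c))))
      ≲⟨ ∑-mono F (λ f → ∑-mono P λ (a , c) → step f (f [ a ]≔ c)) ⟩
    ∑ F (λ f → ∑ P λ (a , c) → s ⋆ dist² (ψ f) (ψ (f [ a ]≔ c)) +
      2 ⋆ (flow ψ f (f [ a ]≔ c) + flow ψ (f [ a ]≔ c) f))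
      ≈⟨ ≃-trans (∑FP-+ _ _) (+-cong (∑FP-⋆ s _) (≃-trans (∑FP-⋆ 2 _) (⋆-cong 2 (∑FP-+ _ _)))) ⟩
    s ⋆ Φ ψ + 2 ⋆ (out + ∑ F (λ f → ∑ P λ (a , c) → flow ψ (f [ a ]≔ c) f))
      -- Relabelling one leaf is a symmetric relation, so the charges on the relabelled states have
      -- the same total as `out`.
      ≈⟨ +-cong (≃-refl {s ⋆ Φ ψ}) (⋆-cong 2 (+-cong (≃-refl {out}) (∑FP-update (flow ψ)))) ⟨
    s ⋆ Φ ψ + 2 ⋆ (out + out)
      ≈⟨ +-cong (≃-refl {s ⋆ Φ ψ}) (⋆-cong 2 (≃-trans (⋆-suc 1 out) (+-cong (≃-refl {out}) (*-identityˡ out)))) ⟨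
    s ⋆ Φ ψ + 2 ⋆ 2 ⋆ out
      ≲⟨ +-mono-≼ (≼-refl {s ⋆ Φ ψ}) (⋆-monoʳ-≼ 2 (⋆-monoʳ-≼ 2 (flow-≤ ψ unit))) ⟩
    s ⋆ Φ ψ + growth    ∎
    where
    open ≼-Reasoning
    out = ∑ F λ f → ∑ P λ (a , c) → flow ψ f (f [ a ]≔ c)
    step : ∀ f g → s ⋆ dist² (oracle (X f) (ψ f)) (oracle (X g) (ψ g)) ≼
      s ⋆ dist² (ψ f) (ψ g) + 2 ⋆ (flow ψ f g + flow ψ g f)
    step f g = ≼-trans
      (dist²-oracle (X f) (X g) (separates f g) s (ω f) (ω g) (agree f g) (ω-balanced {s} 1≤m s²≤m f g) (ψ f) (ψ g))
      (≃⇒≼ (+-cong (≃-refl {s ⋆ dist² (ψ f) (ψ g)}) (⋆-cong 2 (+-cong (≃-refl {flow ψ f g}) (flow-flip ψ f g)))))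

  Φ-unitary : ∀ {U} → IsUnitary U → ∀ ψ → Φ (λ f → U · ψ f) ≃ Φ ψ
  Φ-unitary unitary ψ = ∑FP-cong λ f (a , c) → dist²-unitary unitary (ψ f) (ψ (f [ a ]≔ c))

  Φ-run : ∀ {q} (U : Fin (suc q) → Operator n b w) → (∀ i → IsUnitary (U i)) →
    ∀ ψ → (∀ f → norm² (ψ f) ≃ 1ℝ) → s ⋆ Φ (λ f → run U (X f) (ψ f)) ≼ s ⋆ Φ ψ + q ⋆ growth
  Φ-run {zero} U unitary ψ unit = ≃⇒≼ (≃-trans (⋆-cong s (Φ-unitary (unitary zero) ψ))
    (≃-sym (≃-trans (+-cong (≃-refl {s ⋆ Φ ψ}) (⋆-zeroˡ growth)) (+-identityʳ (s ⋆ Φ ψ)))))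
  Φ-run {suc q} U unitary ψ unit = begin
    s ⋆ Φ (λ f → run (U ∘ suc) (X f) (oracle (X f) (U zero · ψ f)))
      ≲⟨ Φ-run (U ∘ suc) (unitary ∘ suc) _ (λ f → ≃-trans (norm²-oracle (X f) (U zero · ψ f)) (unit′ f)) ⟩
    s ⋆ Φ (λ f → oracle (X f) (U zero · ψ f)) + q ⋆ growth
      ≲⟨ +-mono-≼ (Φ-oracle (λ f → U zero · ψ f) unit′) (≼-refl {q ⋆ growth}) ⟩
    s ⋆ Φ (λ f → U zero · ψ f) + growth + q ⋆ growth
      ≈⟨ +-assoc _ growth (q ⋆ growth) ⟩
    s ⋆ Φ (λ f → U zero · ψ f) + (growth + q ⋆ growth)
      ≈⟨ +-cong (⋆-cong s (Φ-unitary (unitary zero) ψ)) (≃-sym (⋆-suc q growth)) ⟩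
    s ⋆ Φ ψ + suc q ⋆ growth    ∎
    where
    open ≼-Reasoning
    unit′ : ∀ f → norm² (U zero · ψ f) ≃ 1ℝ
    unit′ f = ≃-trans (norm²-unitary (unitary zero) (ψ f)) (unit f)

  Φ-constant : ∀ ψ → Φ (λ _ → ψ) ≃ 0ℝ
  Φ-constant ψ = ≃-trans (∑-cong F λ f → ≃-trans (∑-cong P λ _ → dist²-self ψ) (∑-0 P)) (∑-0 F)

  module Separated {q : ℕ} (ψ : States)
    (separated : ∀ f a c → c ≢ lookup f a → 1ℝ ≼ 18 ⋆ dist² (ψ f) (ψ (f [ a ]≔ c)))
    (evolved : s ⋆ Φ ψ ≼ q ⋆ growth) where

    -- All centres but the current one give a separated pair. The extra `1ℝ` covers the current one
    -- and avoids a subtraction.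
    leaf-bound : ∀ f a → m ⋆ 1ℝ ≼ 18 ⋆ ∑ (fin m) (λ c → dist² (ψ f) (ψ (f [ a ]≔ c))) + 1ℝ
    leaf-bound f a = begin
      m ⋆ 1ℝ                     ≡⟨ cong (_⋆ 1ℝ) (card-fin m) ⟨
      card (fin m) ⋆ 1ℝ          ≈⟨ ∑-const (fin m) 1ℝ ⟨
      ∑ (fin m) (λ _ → 1ℝ)       ≲⟨ ∑-mono (fin m) (λ c → each c (c Fin.≟ lookup f a) refl) ⟩
      ∑ (fin m) (λ c → 18 ⋆ d c + δ c)    ≈⟨ ∑-+ (fin m) _ _ ⟩
      ∑ (fin m) (λ c → 18 ⋆ d c) + ∑ (fin m) δ
        ≈⟨ +-cong (∑-⋆ (fin m) 18 d) (≃-trans (∑-single (fin m) (lookup f a) δ off) on) ⟩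
      18 ⋆ ∑ (fin m) d + 1ℝ      ∎
      where
      open ≼-Reasoning
      d δ : Fin m → ℝ
      d c = dist² (ψ f) (ψ (f [ a ]≔ c))
      δ c = if does (c Fin.≟ lookup f a) then 1ℝ else 0ℝ
      each : ∀ c (e : Dec (c ≡ lookup f a)) → does (c Fin.≟ lookup f a) ≡ does e → 1ℝ ≼ 18 ⋆ d c + δ c
      each c (yes _) eq = ≼-trans (≃⇒≼ (≃-sym (+-identityˡ 1ℝ))) (+-mono-≼
        (⋆-nonneg 18 (≼-trans (≃⇒≼ (≃-sym (∑-0 (basis n b w))))
          (∑-mono (basis n b w) λ t → ∣∣²-nonneg (ψ f t -ᶜ ψ (f [ a ]≔ c) t))))
        (subst (λ b → 1ℝ ≼ (if b then 1ℝ else 0ℝ)) (sym eq) ≼-refl))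
      each c (no c≢) eq = ≼-trans (separated f a c c≢) (≼-trans (≃⇒≼ (≃-sym (+-identityʳ _)))
        (+-mono-≼ ≼-refl (subst (λ b → 0ℝ ≼ (if b then 1ℝ else 0ℝ)) (sym eq) ≼-refl)))
      off : ∀ c → c ≢ lookup f a → δ c ≃ 0ℝ
      off c c≢ = subst (λ b → (if b then 1ℝ else 0ℝ) ≃ 0ℝ) (sym (does-≢ c≢)) ≃-refl
      on : δ (lookup f a) ≃ 1ℝ
      on = subst (λ b → (if b then 1ℝ else 0ℝ) ≃ 1ℝ) (sym (does-≡ {x = lookup f a} refl)) ≃-refl

    Φ-final : card F ⋆ k ⋆ m ⋆ 1ℝ ≼ 18 ⋆ Φ ψ + card F ⋆ k ⋆ 1ℝ
    Φ-final = begin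
      card F ⋆ k ⋆ m ⋆ 1ℝ    ≈⟨ constant (m ⋆ 1ℝ) ⟨
      ∑ F (λ _ → ∑ (fin k) λ _ → m ⋆ 1ℝ)    ≲⟨ ∑-mono F (λ f → ∑-mono (fin k) λ a → leaf-bound f a) ⟩
      ∑ F (λ f → ∑ (fin k) λ a → 18 ⋆ D f a + 1ℝ)
        ≈⟨ ∑-cong F (λ f → ≃-trans (∑-+ (fin k) _ _) (+-cong (∑-⋆ (fin k) 18 (D f)) (≃-refl {∑ (fin k) λ _ → 1ℝ}))) ⟩
      ∑ F (λ f → 18 ⋆ ∑ (fin k) (D f) + ∑ (fin k) λ _ → 1ℝ)
        ≈⟨ ≃-trans (∑-+ F _ _) (+-cong (∑-⋆ F 18 _) (constant 1ℝ)) ⟩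
      18 ⋆ Φ ψ + card F ⋆ k ⋆ 1ℝ    ∎
      where
      open ≼-Reasoning
      D : Labels → Fin k → ℝ
      D f a = ∑ (fin m) λ c → dist² (ψ f) (ψ (f [ a ]≔ c))
      constant : ∀ x → ∑ F (λ _ → ∑ (fin k) λ _ → x) ≃ card F ⋆ k ⋆ x
      constant x = ≃-trans (∑-cong F λ _ → ≃-trans (∑-const (fin k) x) (*-cong (≃-reflexive (cong fromℕ (card-fin k))) (≃-refl {x})))
        (∑-const F (k ⋆ x))

    -- The lower bound on the final potential meets the upper bound from the queries. `Φ ψ` drops
    -- out, and an inequality between naturals remains.
    counting : let M = card F in
      s ℕ.* (M ℕ.* (k ℕ.* m)) ℕ.≤ 18 ℕ.* (q ℕ.* (2 ℕ.* (2 ℕ.* (M ℕ.* (2 ℕ.* m))))) ℕ.+ s ℕ.* (M ℕ.* k)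
    counting = fromℕ-cancel (begin
      fromℕ (s ℕ.* (M ℕ.* (k ℕ.* m)))
        ≈⟨ ⋆ℕ s (M ℕ.* (k ℕ.* m)) (⋆ℕ M (k ℕ.* m) (⋆ℕ k m (*-identityʳ (fromℕ m)))) ⟨
      s ⋆ M ⋆ k ⋆ m ⋆ 1ℝ
        ≲⟨ ⋆-monoʳ-≼ s Φ-final ⟩
      s ⋆ (18 ⋆ Φ ψ + M ⋆ k ⋆ 1ℝ)
        ≈⟨ ≃-trans (⋆-distribˡ s _ _) (+-cong (⋆-swap s 18 (Φ ψ)) (≃-refl {s ⋆ M ⋆ k ⋆ 1ℝ})) ⟩
      18 ⋆ s ⋆ Φ ψ + s ⋆ M ⋆ k ⋆ 1ℝ
        ≲⟨ +-mono-≼ (⋆-monoʳ-≼ 18 evolved) (≼-refl {s ⋆ M ⋆ k ⋆ 1ℝ}) ⟩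
      18 ⋆ q ⋆ growth + s ⋆ M ⋆ k ⋆ 1ℝ
        ≈⟨ +-cong grown (⋆ℕ s (M ℕ.* k) (⋆ℕ M k (*-identityʳ (fromℕ k)))) ⟩
      fromℕ (18 ℕ.* (q ℕ.* (2 ℕ.* (2 ℕ.* (M ℕ.* (2 ℕ.* m)))))) + fromℕ (s ℕ.* (M ℕ.* k))
        ≈⟨ fromℕ-+ (18 ℕ.* (q ℕ.* (2 ℕ.* (2 ℕ.* (M ℕ.* (2 ℕ.* m)))))) (s ℕ.* (M ℕ.* k)) ⟨
      fromℕ (18 ℕ.* (q ℕ.* (2 ℕ.* (2 ℕ.* (M ℕ.* (2 ℕ.* m))))) ℕ.+ s ℕ.* (M ℕ.* k))    ∎)
      where
      open ≼-Reasoning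
      M = card F
      ⋆ℕ : ∀ a b {x} → x ≃ fromℕ b → a ⋆ x ≃ fromℕ (a ℕ.* b)
      ⋆ℕ a b x≃b = ≃-trans (⋆-cong a x≃b) (≃-sym (fromℕ-* a b))
      grown : 18 ⋆ q ⋆ growth ≃ fromℕ (18 ℕ.* (q ℕ.* (2 ℕ.* (2 ℕ.* (M ℕ.* (2 ℕ.* m))))))
      grown = ⋆ℕ 18 (q ℕ.* (2 ℕ.* (2 ℕ.* (M ℕ.* (2 ℕ.* m))))) (⋆ℕ q (2 ℕ.* (2 ℕ.* (M ℕ.* (2 ℕ.* m))))
        (⋆ℕ 2 (2 ℕ.* (M ℕ.* (2 ℕ.* m))) (⋆ℕ 2 (M ℕ.* (2 ℕ.* m)) (⋆ℕ M (2 ℕ.* m) (*-identityʳ (fromℕ (2 ℕ.* m)))))))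
      ⋆-swap : ∀ a b x → a ⋆ b ⋆ x ≃ b ⋆ a ⋆ x
      ⋆-swap a b x = ≃-trans (≃-sym (*-assoc (fromℕ a) (fromℕ b) x))
        (≃-trans (*-cong (*-comm (fromℕ a) (fromℕ b)) (≃-refl {x})) (*-assoc (fromℕ b) (fromℕ a) x))

    M-positive : 1 ℕ.≤ card F
    M-positive = card-positive F (Vec.≡-dec Fin._≟_) (replicate k (fromℕ< 1≤m))

norm²-run : ∀ {n b w q} (U : Fin (suc q) → Operator n b w) → (∀ i → IsUnitary (U i)) →
  ∀ X ψ → norm² (run U X ψ) ≃ norm² ψ
norm²-run {q = zero}  U unitary X ψ = norm²-unitary (unitary zero) ψ
norm²-run {q = suc q} U unitary X ψ = ≃-trans (norm²-run (U ∘ suc) (unitary ∘ suc) X _)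
  (≃-trans (norm²-oracle X (U zero · ψ)) (norm²-unitary (unitary zero) ψ))

-- Distinguishing two final states

-- The difference of the two sides is `∣ 2x - 3y ∣²`.
2∣x∣²≼6∣x-y∣²+3∣y∣² : ∀ x y → 2 ⋆ ∣ x ∣² ≼ 6 ⋆ ∣ x -ᶜ y ∣² + 3 ⋆ ∣ y ∣²
2∣x∣²≼6∣x-y∣²+3∣y∣² (a +i b) (c +i d) = pointwise-≼ λ n → ≤-by-difference
  (ℚ.+-mono-≤ (square-nonneg (two ℚ.* seq a n ℚ.- three ℚ.* seq c n))
              (square-nonneg (two ℚ.* seq b n ℚ.- three ℚ.* seq d n)))
  (solve 4 (λ a b c d →
    con two :* (a :* a :+ b :* b)
      :+ ((con two :* a :- con three :* c) :* (con two :* a :- con three :* c)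
        :+ (con two :* b :- con three :* d) :* (con two :* b :- con three :* d))
    := con (+ 6 / 1) :* ((a :+ :- c) :* (a :+ :- c) :+ (b :+ :- d) :* (b :+ :- d))
      :+ con three :* (c :* c :+ d :* d)) refl (seq a n) (seq b n) (seq c n) (seq d n))
  where
  open +-*-Solver
  two = + 2 / 1
  three = + 3 / 1

module _ {n b w : ℕ} where

  private B = basis n b w

  -- Each outcome has a budget of three times its probability under `φ`. On `S` it helps to bound
  -- `2 ∣ ψ t ∣²`, on `S′` it covers `3 ∣ φ t ∣²`, and disjointness prevents spending it twice.
  -- Summing gives 2 · 2/3 + 3 · 2/3 = 10/3 on the left and at most `6 dist² + 3` on the right;
  -- tripling clears the denominator.
  1≼18dist² : ∀ {ψ φ : State n b w} S S′ → (∀ t → T (S t) → T (S′ t) → ⊥) →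
    norm² φ ≃ 1ℝ → fromℚ (+ 2 / 3) ≼ Pr ψ S → fromℚ (+ 2 / 3) ≼ Pr φ S′ → 1ℝ ≼ 18 ⋆ dist² ψ φ
  1≼18dist² {ψ} {φ} S S′ disjoint unit P P′ = +-cancelʳ-≼ (fromℕ 9) (begin
    1ℝ + fromℕ 9
      ≈⟨ pointwise-≃ (λ _ → refl) ⟩
    3 ⋆ (2 ⋆ fromℚ (+ 2 / 3) + 3 ⋆ fromℚ (+ 2 / 3))
      ≲⟨ ⋆-monoʳ-≼ 3 (+-mono-≼ (⋆-monoʳ-≼ 2 P) (⋆-monoʳ-≼ 3 P′)) ⟩
    3 ⋆ (2 ⋆ Pr ψ S + 3 ⋆ Pr φ S′)
      ≈⟨ ⋆-cong 3 (≃-trans (∑-+ B _ _) (+-cong (∑-⋆ B 2 _) (∑-⋆ B 3 _))) ⟨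
    3 ⋆ ∑ B (λ t → 2 ⋆ (if S t then ∣ ψ t ∣² else 0ℝ) + 3 ⋆ (if S′ t then ∣ φ t ∣² else 0ℝ))
      ≲⟨ ⋆-monoʳ-≼ 3 (∑-mono B λ t → cases t (S t) (S′ t) (disjoint t)) ⟩
    3 ⋆ ∑ B (λ t → 6 ⋆ ∣ ψ t -ᶜ φ t ∣² + 3 ⋆ ∣ φ t ∣²)
      ≈⟨ ⋆-cong 3 (≃-trans (∑-+ B _ _) (+-cong (∑-⋆ B 6 _) (∑-⋆ B 3 _))) ⟩
    3 ⋆ (6 ⋆ dist² ψ φ + 3 ⋆ norm² φ)
      ≈⟨ ⋆-distribˡ 3 (6 ⋆ dist² ψ φ) (3 ⋆ norm² φ) ⟩
    3 ⋆ 6 ⋆ dist² ψ φ + 3 ⋆ 3 ⋆ norm² φ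
      ≈⟨ +-cong (⋆-assoc 3 6 (dist² ψ φ)) (≃-sym (⋆-cong 3 (⋆-cong 3 unit))) ⟨
    18 ⋆ dist² ψ φ + 3 ⋆ 3 ⋆ 1ℝ
      ≈⟨ +-cong (≃-refl {18 ⋆ dist² ψ φ}) (pointwise-≃ {3 ⋆ 3 ⋆ 1ℝ} {fromℕ 9} λ _ → refl) ⟩
    18 ⋆ dist² ψ φ + fromℕ 9    ∎)
    where
    open ≼-Reasoning
    cases : ∀ t s s′ → (T s → T s′ → ⊥) →
      2 ⋆ (if s then ∣ ψ t ∣² else 0ℝ) + 3 ⋆ (if s′ then ∣ φ t ∣² else 0ℝ) ≼
      6 ⋆ ∣ ψ t -ᶜ φ t ∣² + 3 ⋆ ∣ φ t ∣²
    cases t true  true  ¬both = ⊥-elim (¬both tt tt)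
    cases t true  false _ = ≼-trans
      (≃⇒≼ (≃-trans (+-cong (≃-refl {2 ⋆ ∣ ψ t ∣²}) (⋆-zeroʳ 3)) (+-identityʳ (2 ⋆ ∣ ψ t ∣²))))
      (2∣x∣²≼6∣x-y∣²+3∣y∣² (ψ t) (φ t))
    cases t false s′ _ = +-mono-≼
      (≼-trans (≃⇒≼ (⋆-zeroʳ 2)) (⋆-nonneg 6 (∣∣²-nonneg (ψ t -ᶜ φ t))))
      (⋆-monoʳ-≼ 3 (if-≼ s′))
      where
      if-≼ : ∀ s′ → (if s′ then ∣ φ t ∣² else 0ℝ) ≼ ∣ φ t ∣²
      if-≼ true  = ≼-refl
      if-≼ false = ∣∣²-nonneg (φ t)

-- The metrics

-- The word true ∷ true ∷ [] is never an answer; its value only has to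
-- differ from the other three.
number : ℕ → Vec Bool 2 → ℕ
number D (false ∷ false ∷ []) = 0
number D (false ∷ true  ∷ []) = 1
number D (true  ∷ false ∷ []) = D
number D (true  ∷ true  ∷ []) = suc D

number-injective : ∀ B {v v′} → number (2 ℕ.+ B) v ≡ number (2 ℕ.+ B) v′ → v ≡ v′
number-injective B {false ∷ false ∷ []} {false ∷ false ∷ []} _ = refl
number-injective B {false ∷ true  ∷ []} {false ∷ true  ∷ []} _ = refl
number-injective B {true  ∷ false ∷ []} {true  ∷ false ∷ []} _ = refl
number-injective B {true  ∷ true  ∷ []} {true  ∷ true  ∷ []} _ = refl
number-injective B {false ∷ false ∷ []} {false ∷ true  ∷ []} ()
number-injective B {false ∷ false ∷ []} {true  ∷ true  ∷ []} ()
number-injective B {false ∷ true  ∷ []} {false ∷ false ∷ []} ()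
number-injective B {false ∷ true  ∷ []} {true  ∷ false ∷ []} ()
number-injective B {true  ∷ false ∷ []} {true  ∷ true  ∷ []} e = contradiction (sym e) ℕ.1+n≢n
number-injective B {true  ∷ true  ∷ []} {true  ∷ false ∷ []} e = contradiction e ℕ.1+n≢n

-- The offset in `2 + B` serves twice: it keeps the large distance different from 0 and 1, as
-- injectivity demands, and puts it above `B`, hence above `α`.
code : ℕ → Code
code B = record
  { bits      = 2
  ; value     = λ v → fromℕ (number (2 ℕ.+ B) v)
  ; injective = λ e → number-injective B (fromℕ-injective (wrap e))
  }

word : Bool → Bool → Vec Bool 2
word true  _     = false ∷ false ∷ []
word false true  = false ∷ true ∷ []
word false false = true ∷ false ∷ []

≤-isPartialOrder : IsPartialOrder _≈_ _≤_
≤-isPartialOrder = record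
  { isPreorder = record
    { isEquivalence = record
      { refl  = λ {x} → _≃_.unwrap (≃-refl {x})
      ; sym   = λ {x} {y} e → _≃_.unwrap (≃-sym {x} {y} (wrap e))
      ; trans = λ {x} {y} {z} e e′ → _≃_.unwrap (≃-trans {x} {y} {z} (wrap e) (wrap e′))
      }
    ; reflexive = λ {x} {y} e → _≼_.unwrap (≃⇒≼ {x} {y} (wrap e))
    ; trans     = λ {x} {y} {z} e e′ → _≼_.unwrap (≼-trans {x} {y} {z} (wrap e) (wrap e′))
    }
  ; antisym = λ {x} {y} e e′ → _≃_.unwrap (≼-antisym {x} {y} (wrap e) (wrap e′))
  }

module Clusters {n m : ℕ} (ℓ : Fin n → Fin m) where

  words : Answers n 2
  words i j = word (does (i Fin.≟ j)) (does (ℓ i Fin.≟ ℓ j))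

  words-together : ∀ {i j} → i ≢ j → ℓ i ≡ ℓ j → words i j ≡ false ∷ true ∷ []
  words-together {i} {j} i≢j eq with i Fin.≟ j | ℓ i Fin.≟ ℓ j
  ... | yes i≡j | _      = contradiction i≡j i≢j
  ... | no _    | yes _  = refl
  ... | no _    | no  ne = contradiction eq ne

  words-apart : ∀ {i j} → ℓ i ≢ ℓ j → words i j ≡ true ∷ false ∷ []
  words-apart {i} {j} ne with i Fin.≟ j | ℓ i Fin.≟ ℓ j
  ... | yes refl | _      = contradiction refl ne
  ... | no _     | yes eq = contradiction eq ne
  ... | no _     | no _   = refl

  module _ (B : ℕ) where

    δ : Fin n → Fin n → ℕ
    δ i j = number (2 ℕ.+ B) (words i j)

    δ-self : ∀ i → δ i i ≡ 0
    δ-self i with i Fin.≟ i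
    ... | yes _  = refl
    ... | no i≢i = contradiction refl i≢i

    δ-zero : ∀ i j → δ i j ≡ 0 → i ≡ j
    δ-zero i j δ≡0 with i Fin.≟ j | ℓ i Fin.≟ ℓ j
    ... | yes i≡j | _     = i≡j
    ... | no _    | yes _ with () ← δ≡0
    ... | no _    | no _  with () ← δ≡0

    δ-≥1 : ∀ i j → i ≢ j → 1 ℕ.≤ δ i j
    δ-≥1 i j i≢j = ℕ.n≢0⇒n>0 (i≢j ∘ δ-zero i j)

    δ-≤D : ∀ i j → δ i j ℕ.≤ 2 ℕ.+ B
    δ-≤D i j with i Fin.≟ j | ℓ i Fin.≟ ℓ j
    ... | yes _ | _     = ℕ.z≤n
    ... | no _  | yes _ = ℕ.s≤s ℕ.z≤n
    ... | no _  | no _  = ℕ.≤-refl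

    δ-together : ∀ i j → ℓ i ≡ ℓ j → δ i j ℕ.≤ 1
    δ-together i j eq with i Fin.≟ j | ℓ i Fin.≟ ℓ j
    ... | yes _ | _     = ℕ.z≤n
    ... | no _  | yes _ = ℕ.≤-refl
    ... | no _  | no ne = contradiction eq ne

    δ-apart : ∀ i j → ℓ i ≢ ℓ j → δ i j ≡ 2 ℕ.+ B
    δ-apart i j ne = cong (number (2 ℕ.+ B)) (words-apart ne)

    δ-sym : ∀ i j → δ i j ≡ δ j i
    δ-sym i j with i Fin.≟ j | j Fin.≟ i | ℓ i Fin.≟ ℓ j | ℓ j Fin.≟ ℓ i
    ... | yes _    | yes _    | _      | _      = refl
    ... | yes i≡j  | no j≢i   | _      | _      = contradiction (sym i≡j) j≢i
    ... | no i≢j   | yes j≡i  | _      | _      = contradiction (sym j≡i) i≢j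
    ... | no _     | no _     | yes _  | yes _  = refl
    ... | no _     | no _     | no _   | no _   = refl
    ... | no _     | no _     | yes eq | no ne  = contradiction (sym eq) ne
    ... | no _     | no _     | no ne  | yes eq = contradiction (sym eq) ne

    -- A leg between clusters already has the largest possible length. Without such a leg all three
    -- points share a cluster, where distances are at most 1 and a leg between distinct points is at
    -- least 1.
    δ-triangle : ∀ i j l → δ i l ℕ.≤ δ i j ℕ.+ δ j l
    δ-triangle i j l = cases (i Fin.≟ j) (j Fin.≟ l) (ℓ i Fin.≟ ℓ j) (ℓ j Fin.≟ ℓ l)
      where
      cases : Dec (i ≡ j) → Dec (j ≡ l) → Dec (ℓ i ≡ ℓ j) → Dec (ℓ j ≡ ℓ l) → δ i l ℕ.≤ δ i j ℕ.+ δ j l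
      cases (yes refl) _ _ _ = ℕ.m≤n+m (δ i l) _
      cases (no _) (yes refl) _ _ = ℕ.m≤m+n (δ i l) _
      cases (no _) (no _) (no ij) _ =
        ℕ.≤-trans (δ-≤D i l) (ℕ.≤-trans (ℕ.≤-reflexive (sym (δ-apart i j ij))) (ℕ.m≤m+n (δ i j) _))
      cases (no _) (no _) (yes _) (no jl) =
        ℕ.≤-trans (δ-≤D i l) (ℕ.≤-trans (ℕ.≤-reflexive (sym (δ-apart j l jl))) (ℕ.m≤n+m (δ j l) _))
      cases (no i≢j) (no _) (yes ij) (yes jl) =
        ℕ.≤-trans (δ-together i l (trans ij jl)) (ℕ.≤-trans (δ-≥1 i j i≢j) (ℕ.m≤m+n (δ i j) _))

    isMetric : IsMetric (λ i j → Code.value (code B) (words i j))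
    isMetric = record
      { isSemiMetric = record
        { isQuasiSemiMetric = record
          { isPreMetric = record
            { isProtoMetric = record
              { isPartialOrder  = ≤-isPartialOrder
              ; ≈-isEquivalence = isEquivalence
              ; cong            = λ { {i} {_} {j} refl refl → equal (refl {x = δ i j}) }
              ; nonNegative     = λ {i} {j} → _≼_.unwrap (fromℕ-mono {0} {δ i j} ℕ.z≤n)
              }
            ; ≈⇒0 = λ { {i} refl → equal (δ-self i) }
            }
          ; 0⇒≈ = λ {i} {j} e → δ-zero i j (fromℕ-injective {δ i j} {0} (wrap e))
          }
        ; sym = λ i j → equal (δ-sym i j)
        }
      ; triangle = λ i j l → _≼_.unwrap (≼-trans (fromℕ-mono (δ-triangle i j l)) (≃⇒≼ (fromℕ-+ (δ i j) (δ j l))))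
      }
      where
      equal : ∀ {a b} → a ≡ b → fromℕ a ≈ fromℕ b
      equal {a} refl = _≃_.unwrap (≃-refl {fromℕ a})

-- The lower bound

xor-false : ∀ {x y} → x xor y ≡ false → x ≡ y
xor-false {true}  {true}  _ = refl
xor-false {false} {false} _ = refl

-- A common approximation would satisfy `2 + B ≤ A i j ≤ α ≤ B` at this one entry.
approximations-disjoint : ∀ {n} α B (d d′ A : DistanceMatrix n) i j → α ≼ fromℕ B →
  d i j ≡ fromℕ (2 ℕ.+ B) → d′ i j ≡ 1ℝ → Approximates α d A → Approximates α d′ A → ⊥
approximations-disjoint α B d d′ A i j α≼B far near d≈A d′≈A =
  ℕ.<-irrefl refl (ℕ.<-trans (ℕ.n<1+n B) (fromℕ-cancel {2 ℕ.+ B} {B} (begin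
    fromℕ (2 ℕ.+ B)    ≡⟨ far ⟨
    d i j              ≲⟨ wrap {d i j} {A i j} (proj₁ (d≈A i j)) ⟩
    A i j              ≲⟨ wrap {A i j} {α * d′ i j} (proj₂ (d′≈A i j)) ⟩
    α * d′ i j         ≡⟨ cong (α *_) near ⟩
    α * 1ℝ             ≈⟨ *-identityʳ α ⟩
    α                  ≲⟨ α≼B ⟩
    fromℕ B            ∎)))
  where open ≼-Reasoning

module Instances (bound k m : ℕ) where

  open Labelling (splitAt k {m}) public

  X : Labels → Answers (k ℕ.+ m) 2
  X f = Clusters.words (label f)

  distance : Labels → DistanceMatrix (k ℕ.+ m)
  distance f i j = value (code bound) (X f i j)

-- The success sets are a parameter because type checking compares them often,
-- and as applications of Estimates they contain proofs of IsMetric.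
module Adversary {q : ℕ} (α : ℝ) (bound : ℕ) (α≼bound : α ≼ fromℕ bound)
  (k m : ℕ) (C : Circuit (k ℕ.+ m) 2 q)
  (success : ∀ f → ∃[ S ] ((∀ t → T (S t) → Approximates α (Instances.distance bound k m f) (Circuit.output C t)) ×
    (fromℚ (+ 2 / 3) ≼ Pr (Circuit.final C (Instances.X bound k m f)) S)))
  (s : ℕ) (1≤m : 1 ℕ.≤ m) (s²≤m : s ℕ.* s ℕ.≤ m) where

  open Instances bound k m
  open Circuit C

  agree : ∀ f g i j → separates f g i j ≡ false → X f i j ≡ X g i j
  agree f g i j same = cong (word (does (i Fin.≟ j))) (xor-false same)

  open Potential {w = workspace} {s = s} (splitAt k) X agree 1≤m s²≤m

  ψ : States
  ψ f = final (X f)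

  norm²-ψ : ∀ f → norm² (ψ f) ≃ 1ℝ
  norm²-ψ f = ≃-trans (norm²-run gate unitary (X f) (ket initial)) (norm²-ket initial)

  -- The witnessing entry is the leaf `a` against its new centre `c`: in different clusters under
  -- `f`, in the same one after the move.
  incompatible : ∀ f a c → c ≢ lookup f a → ∀ t →
    T (proj₁ (success f) t) → T (proj₁ (success (f [ a ]≔ c)) t) → ⊥
  incompatible f a c c≢fa t t∈S t∈S′ = approximations-disjoint α bound (distance f) (distance g) (output t) i j α≼bound far near
    (proj₁ (proj₂ (success f)) t t∈S) (proj₁ (proj₂ (success g)) t t∈S′)
    where
    g = f [ a ]≔ c
    i = a ↑ˡ m
    j = k ↑ʳ c
    label-leaf : ∀ h → label h i ≡ lookup h a
    label-leaf h = cong [ lookup h , id ]′ (Fin.splitAt-↑ˡ k a m)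
    label-centre : ∀ h → label h j ≡ c
    label-centre h = cong [ lookup h , id ]′ (Fin.splitAt-↑ʳ k m c)
    f-apart : label f i ≢ label f j
    f-apart eq = c≢fa (trans (sym (label-centre f)) (trans (sym eq) (label-leaf f)))
    g-together : label g i ≡ label g j
    g-together = trans (label-leaf g) (trans (Vec.lookup∘updateAt a f) (sym (label-centre g)))
    far : distance f i j ≡ fromℕ (2 ℕ.+ bound)
    far = cong (value (code bound)) (Clusters.words-apart (label f) f-apart)
    near : distance g i j ≡ 1ℝ
    near = cong (value (code bound)) (Clusters.words-together (label g) (f-apart ∘ cong (label f)) g-together)

  1≼18dist²-ψ : ∀ f a c → c ≢ lookup f a → 1ℝ ≼ 18 ⋆ dist² (ψ f) (ψ (f [ a ]≔ c))
  1≼18dist²-ψ f a c c≢fa = 1≼18dist² {ψ = ψ f} {φ = ψ (f [ a ]≔ c)} (proj₁ (success f)) (proj₁ (success (f [ a ]≔ c)))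
    (incompatible f a c c≢fa) (norm²-ψ (f [ a ]≔ c))
    (proj₂ (proj₂ (success f))) (proj₂ (proj₂ (success (f [ a ]≔ c))))

  Φ-ψ : s ⋆ Φ ψ ≼ q ⋆ growth
  Φ-ψ = begin
    s ⋆ Φ ψ    ≲⟨ Φ-run gate unitary (λ _ → ket initial) (λ _ → norm²-ket initial) ⟩
    s ⋆ Φ (λ _ → ket initial) + q ⋆ growth
      ≈⟨ +-cong (≃-trans (⋆-cong s (Φ-constant (ket initial))) (⋆-zeroʳ s)) (≃-refl {q ⋆ growth}) ⟩
    0ℝ + q ⋆ growth    ≈⟨ +-identityˡ _ ⟩
    q ⋆ growth    ∎
    where open ≼-Reasoning


  open Separated {q} ψ 1≼18dist²-ψ Φ-ψ public

-- Arithmetic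

-- The last summand stems from the moves that leave a leaf where it is; cancelling it turns `suc m`
-- into `m` on the left. The remaining `suc m` on the right is absorbed by `k`, so that `M k`
-- cancels, and 144 = 18 · 2 · 2 · 2.
cancel-labellings : ∀ s M k m q → 1 ℕ.≤ M → suc m ℕ.≤ k →
  s ℕ.* (M ℕ.* (k ℕ.* suc m)) ℕ.≤ 18 ℕ.* (q ℕ.* (2 ℕ.* (2 ℕ.* (M ℕ.* (2 ℕ.* suc m))))) ℕ.+ s ℕ.* (M ℕ.* k) →
  s ℕ.* m ℕ.≤ 144 ℕ.* q
cancel-labellings s M k m q 1≤M m<k le = ℕ.*-cancelˡ-≤ (M ℕ.* k) {{Mk≢0}} (begin
  M ℕ.* k ℕ.* (s ℕ.* m)              ≤⟨ ℕ.+-cancelʳ-≤ (s ℕ.* (M ℕ.* k)) _ _ (ℕ.≤-trans (ℕ.≤-reflexive (sym (left s M k m))) le) ⟩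
  18 ℕ.* (q ℕ.* (2 ℕ.* (2 ℕ.* (M ℕ.* (2 ℕ.* suc m)))))    ≡⟨ right M (suc m) q ⟩
  M ℕ.* suc m ℕ.* (144 ℕ.* q)        ≤⟨ ℕ.*-monoˡ-≤ (144 ℕ.* q) (ℕ.*-monoʳ-≤ M m<k) ⟩
  M ℕ.* k ℕ.* (144 ℕ.* q)            ∎)
  where
  open ℕ.≤-Reasoning
  open ℕ-Solver.+-*-Solver
  Mk≢0 : ℕ.NonZero (M ℕ.* k)
  Mk≢0 = ℕ.>-nonZero (ℕ.*-mono-≤ 1≤M (ℕ.≤-trans (ℕ.s≤s ℕ.z≤n) m<k))
  left : ∀ s M k m → s ℕ.* (M ℕ.* (k ℕ.* suc m)) ≡ M ℕ.* k ℕ.* (s ℕ.* m) ℕ.+ s ℕ.* (M ℕ.* k)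
  left = solve 4 (λ s M k m → s :* (M :* (k :* (con 1 :+ m))) := M :* k :* (s :* m) :+ s :* (M :* k)) refl
  right : ∀ M m q → 18 ℕ.* (q ℕ.* (2 ℕ.* (2 ℕ.* (M ℕ.* (2 ℕ.* m))))) ≡ M ℕ.* m ℕ.* (144 ℕ.* q)
  right = solve 3 (λ M m q →
    con 18 :* (q :* (con 2 :* (con 2 :* (M :* (con 2 :* m))))) := M :* m :* (con 144 :* q)) refl

-- 2592 = 18 · 144, and 25 · 12 ≤ 18².
cube-≤ : ∀ n m s q → n ℕ.≤ 3 ℕ.+ 2 ℕ.* m → 1 ℕ.≤ m → suc m ℕ.≤ suc s ℕ.* suc s → 1 ℕ.≤ s →
  s ℕ.* m ℕ.≤ 144 ℕ.* q → n ℕ.^ 3 ℕ.≤ (2592 ℕ.* q) ℕ.* (2592 ℕ.* q)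
cube-≤ n m s q n≤ 1≤m m≤ 1≤s sm≤ = begin
  n ℕ.* (n ℕ.* (n ℕ.* 1))                        ≤⟨ ℕ.*-mono-≤ n≤12s² (ℕ.*-mono-≤ n≤5m (ℕ.*-monoˡ-≤ 1 n≤5m)) ⟩
  12 ℕ.* (s ℕ.* s) ℕ.* (5 ℕ.* m ℕ.* (5 ℕ.* m ℕ.* 1))  ≡⟨ collect s m ⟩
  300 ℕ.* (s ℕ.* m ℕ.* (s ℕ.* m))                ≤⟨ ℕ.*-mono-≤ (ℕ.m≤m+n 300 24) (ℕ.*-mono-≤ sm≤ sm≤) ⟩
  324 ℕ.* (144 ℕ.* q ℕ.* (144 ℕ.* q))            ≡⟨ expand q ⟩
  2592 ℕ.* q ℕ.* (2592 ℕ.* q)                    ∎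
  where
  open ℕ.≤-Reasoning
  open ℕ-Solver.+-*-Solver
  collect : ∀ s m → 12 ℕ.* (s ℕ.* s) ℕ.* (5 ℕ.* m ℕ.* (5 ℕ.* m ℕ.* 1)) ≡ 300 ℕ.* (s ℕ.* m ℕ.* (s ℕ.* m))
  collect = solve 2 (λ s m → con 12 :* (s :* s) :* (con 5 :* m :* (con 5 :* m :* con 1))
    := con 300 :* (s :* m :* (s :* m))) refl
  expand : ∀ q → 324 ℕ.* (144 ℕ.* q ℕ.* (144 ℕ.* q)) ≡ 2592 ℕ.* q ℕ.* (2592 ℕ.* q)
  expand = solve 1 (λ q → con 324 :* (con 144 :* q :* (con 144 :* q)) := con 2592 :* q :* (con 2592 :* q)) refl
  n≤5m : n ℕ.≤ 5 ℕ.* m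
  n≤5m = begin
    n                        ≤⟨ n≤ ⟩
    3 ℕ.+ 2 ℕ.* m            ≤⟨ ℕ.+-monoˡ-≤ (2 ℕ.* m) (ℕ.*-monoʳ-≤ 3 1≤m) ⟩
    3 ℕ.* m ℕ.+ 2 ℕ.* m      ≡⟨ sym (ℕ.*-distribʳ-+ m 3 2) ⟩
    5 ℕ.* m                  ∎
  n≤12s² : n ℕ.≤ 12 ℕ.* (s ℕ.* s)
  n≤12s² = begin
    n                                  ≤⟨ n≤ ⟩
    3 ℕ.+ 2 ℕ.* m                      ≤⟨ ℕ.+-monoʳ-≤ 3 (ℕ.*-monoˡ-≤ m (ℕ.n≤1+n 2)) ⟩
    3 ℕ.+ 3 ℕ.* m                      ≡⟨ sym (ℕ.*-suc 3 m) ⟩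
    3 ℕ.* suc m                        ≤⟨ ℕ.*-monoʳ-≤ 3 (ℕ.≤-trans m≤ (ℕ.*-mono-≤ s+1≤2s s+1≤2s)) ⟩
    3 ℕ.* (2 ℕ.* s ℕ.* (2 ℕ.* s))      ≡⟨ solve 1 (λ s → con 3 :* (con 2 :* s :* (con 2 :* s)) := con 12 :* (s :* s)) refl s ⟩
    12 ℕ.* (s ℕ.* s)                   ∎
    where
    s+1≤2s : suc s ℕ.≤ 2 ℕ.* s
    s+1≤2s = ℕ.≤-trans (ℕ.+-monoˡ-≤ s 1≤s) (ℕ.≤-reflexive (cong (s ℕ.+_) (sym (ℕ.+-identityʳ s))))

-- The approximants round the root down, so the bound holds at every index and no limit has to be
-- taken.
√-seq-≤ : ∀ n r → n ℕ.≤ r ℕ.* r → ∀ k → √-seq n k ℚ.≤ + r / 1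
√-seq-≤ n r n≤r² k = /-mono (proj₁ (root k)) k
  (square-cancel-≤ (ℕ.≤-trans (proj₁ (proj₂ (root k)))
    (ℕ.≤-trans (ℕ.*-monoˡ-≤ (suc k ℕ.* suc k) n≤r²)
      (ℕ.≤-reflexive (solve 2 (λ r k → r :* r :* (k :* k) := r :* k :* (r :* k)) refl r (suc k))))))
  where
  open ℕ-Solver.+-*-Solver
  root = λ k → isqrt (n ℕ.* (suc k ℕ.* suc k))
  square-cancel-≤ : ∀ {a b} → a ℕ.* a ℕ.≤ b ℕ.* b → a ℕ.≤ b
  square-cancel-≤ {a} {b} le = ℕ.≮⇒≥ λ b<a → ℕ.<⇒≱ (ℕ.*-mono-< b<a b<a) le
  /-mono : ∀ a j → a ℕ.≤ r ℕ.* suc j → + a / suc j ℚ.≤ + r / 1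
  /-mono a j le = ℚ.toℚᵘ-cancel-≤
    (ℚᵘ.≤-respˡ-≃ (ℚᵘ.≃-sym (ℚ.toℚᵘ-fromℚᵘ (ℚᵘ.mkℚᵘ (+ a) j)))
      (ℚᵘ.≤-respʳ-≃ (ℚᵘ.≃-sym (ℚ.toℚᵘ-fromℚᵘ (ℚᵘ.mkℚᵘ (+ r) 0)))
        (ℚᵘ.*≤* (ℤ.≤-trans (ℤ.≤-reflexive (ℤ.*-identityʳ (+ a)))
          (ℤ.≤-trans (ℤ.+≤+ le) (ℤ.≤-reflexive (ℤ.pos-* r (suc j))))))))

-- The hard code depends on `α`, but `q` is the same for all codes, so bounding the single circuit
-- for `code B` is enough.
adversary-bound : ∀ α k m q (𝒜 : QuantumAlgorithm (k ℕ.+ suc m) q) → Estimates α 𝒜 → suc m ℕ.≤ k →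
  ∀ s → s ℕ.* s ℕ.≤ suc m → s ℕ.* m ℕ.≤ 144 ℕ.* q
adversary-bound α k m q 𝒜 correct m<k s s²≤m =
  cancel-labellings s (card (vec (fin (suc m)) k)) k m q M-positive m<k counting
  where
  B = proj₁ (bounded-by-ℕ α)
  success : ∀ f → ∃[ S ] ((∀ t → T (S t) →
      Approximates α (Instances.distance B k (suc m) f) (Circuit.output (𝒜 (code B)) t)) ×
    (fromℚ (+ 2 / 3) ≼ Pr (Circuit.final (𝒜 (code B)) (Instances.X B k (suc m) f)) S))
  success f =
    let S , sound , likely = correct (code B) (Instances.X B k (suc m) f)
          (Clusters.isMetric (Labelling.label (splitAt k) f) B)
    in S , sound , wrap likely
  open Adversary {q} α B (proj₂ (bounded-by-ℕ α)) k (suc m) (𝒜 (code B)) success s (ℕ.s≤s ℕ.z≤n) s²≤m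

quantum-queries : ∀ α n → 4 ℕ.≤ n → ∀ q (𝒜 : QuantumAlgorithm n q) → Estimates α 𝒜 →
  n ℕ.^ 3 ℕ.≤ (2592 ℕ.* q) ℕ.* (2592 ℕ.* q)
quantum-queries α n 4≤n = halves ⌈ n /2⌉ ⌊ n /2⌋ (trans (ℕ.+-comm ⌈ n /2⌉ ⌊ n /2⌋) (ℕ.⌊n/2⌋+⌈n/2⌉≡n n))
  (ℕ.⌊n/2⌋-mono 4≤n) (ℕ.⌊n/2⌋≤⌈n/2⌉ n) (ℕ.⌊n/2⌋-mono (ℕ.n≤1+n (suc n)))
  where
  -- Keeping `n` general lets `refl` turn it into `k + suc m` inside the type of `𝒜`. At least two
  -- centres are needed for a leaf to move at all, whence `4 ≤ n`.
  halves : ∀ k m {n} → k ℕ.+ m ≡ n → 2 ℕ.≤ m → m ℕ.≤ k → k ℕ.≤ suc m → ∀ q (𝒜 : QuantumAlgorithm n q) →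
    Estimates α 𝒜 → n ℕ.^ 3 ℕ.≤ (2592 ℕ.* q) ℕ.* (2592 ℕ.* q)
  halves k (suc m) refl (ℕ.s≤s 1≤m) m<k k≤ q 𝒜 correct =
    let s , s²≤ , <s² = isqrt (suc m) in
    cube-≤ (k ℕ.+ suc m) m s q
      (ℕ.≤-trans (ℕ.+-monoˡ-≤ (suc m) k≤) (ℕ.≤-reflexive (size m)))
      1≤m (ℕ.<⇒≤ <s²) (root-positive s <s²)
      (adversary-bound α k m q 𝒜 correct m<k s s²≤)
    where
    open ℕ-Solver.+-*-Solver using (solve; con; _:+_; _:*_; _:=_)
    size : ∀ m → suc (suc m) ℕ.+ suc m ≡ 3 ℕ.+ 2 ℕ.* m
    size = solve 1 (λ m → (con 2 :+ m) :+ (con 1 :+ m) := con 3 :+ con 2 :* m) refl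
    root-positive : ∀ s → suc m ℕ.< suc s ℕ.* suc s → 1 ℕ.≤ s
    root-positive zero    (ℕ.s≤s ())
    root-positive (suc s) _ = ℕ.s≤s ℕ.z≤n

mainTheorem11 : ∀ (α : ℝ) → ∃[ c ] (0ℝ < c × ∃[ N ] (∀ (n : ℕ) → N ℕ.≤ n →
    ∀ (q : ℕ) (𝒜 : QuantumAlgorithm n q) → Estimates α 𝒜 →
    c * n ^[3/2] ≤ fromℕ q))
mainTheorem11 α = c , (1/2592 , ℚ.positive⁻¹ 1/2592 , 0 , λ _ _ → ℚ.≤-reflexive (ℚ.+-identityˡ 1/2592)) ,
  4 , λ n 4≤n q 𝒜 correct → _≼_.unwrap (scaled n q (quantum-queries α n 4≤n q 𝒜 correct))
  where
  -- The constant is the same for every `α`, which enters only through the distance between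
  -- clusters, a number absent from the counting.
  1/2592 = + 1 / 2592
  c = fromℚ 1/2592
  open ≼-Reasoning
  scaled : ∀ n q → n ℕ.^ 3 ℕ.≤ (2592 ℕ.* q) ℕ.* (2592 ℕ.* q) → c * n ^[3/2] ≼ fromℕ q
  scaled n q n³≤ = begin
    c * n ^[3/2]                   ≲⟨ pointwise-≼ (λ k → ℚ.*-monoˡ-≤-nonNeg 1/2592 (√-seq-≤ (n ℕ.^ 3) (2592 ℕ.* q) n³≤ k)) ⟩
    c * fromℕ (2592 ℕ.* q)         ≈⟨ *-cong (≃-refl {c}) (fromℕ-* 2592 q) ⟩
    c * (fromℕ 2592 * fromℕ q)     ≈⟨ *-assoc c (fromℕ 2592) (fromℕ q) ⟨
    c * fromℕ 2592 * fromℕ q       ≈⟨ *-cong (pointwise-≃ {c * fromℕ 2592} {1ℝ} λ _ → refl) (≃-refl {fromℕ q}) ⟩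
    1ℝ * fromℕ q                   ≈⟨ *-identityˡ (fromℕ q) ⟩
    fromℕ q                        ∎
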